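{- For every integer $k\ge2$ and every rational number $x$, \[ G_{\mathcal{A}}(k;x)=(-1)^{k-1}\sum_{j=0}^{k}(-1)^j\binom{k}{j}\ell_{\mathcal{A}}(x+j+1)\quad\text{in }\mathcal{A}. \]
   Context: $\mathcal{A}\coloneqq\big(\prod_{p\text{ prime}}\mathbb{Z}/p\mathbb{Z}\big)/\big(\bigoplus_{p\text{ prime}}\mathbb{Z}/p\mathbb{Z}\big)$, a $\mathbb{Q}$-algebra via the diagonal embedding of $\mathbb{Q}$ (for the finitely many primes dividing a denominator, the $p$-component is assigned arbitrarily). Gregory polynomials $G_n(x)\in\mathbb{Q}[x]$ are defined by $\frac{t(1+t)^x}{\log(1+t)}=\sum_{n\ge0}G_n(x)t^n$. For $k\ge2$ and $x\in\mathbb{Q}$, $G_{\mathcal{A}}(k;x)\coloneqq(G_{p-k}(x)\bmod p)_p\in\mathcal{A}$. For $x\in\mathbb{Q}$, $\ell_{\mathcal{A}}(x)\coloneqq\big(\frac{x^p-x}{p}\bmod p\big)_p$ ($x$ times the Fermat quotient $\frac{x^{p-1}-1}{p}$; $\ell_{\mathcal{A}}(0)=0$). -}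

module Defs where

open import Data.Nat as ℕ using (ℕ; zero; suc; _<_; _∸_)
open import Data.Nat.Divisibility using (_∣_)
open import Data.Nat.Primality using (Prime)
open import Data.Nat.Combinatorics using (_C_)
open import Data.Integer as ℤ using (ℤ; +_)
open import Data.Rational as ℚ using (ℚ; _+_; _*_; _-_; -_; ↥_; 0ℚ; 1ℚ)
open import Data.Product using (∃; Σ)
open import Data.Bool using (if_then_else_)

_^ℚ_ : ℚ → ℕ → ℚ
q ^ℚ zero  = 1ℚ
q ^ℚ suc n = q * (q ^ℚ n)

ℕ→ℚ : ℕ → ℚ
ℕ→ℚ n = + n ℚ./ 1

sgn : ℕ → ℚ
sgn zero = 1ℚ
sgn (suc n) = - sgn n

sumTo : ℕ → (ℕ → ℚ) → ℚ
sumTo zero    f = f 0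
sumTo (suc n) f = sumTo n f + f (suc n)

-- Coefficients a_i = (-1)^i / (i+1) of log(1+t)/t
logCoeff : ℕ → ℚ
logCoeff i = sgn i * (+ 1 ℚ./ suc i)

-- Gregory coefficients g_n: coefficients of t/log(1+t), i.e. the
-- multiplicative inverse of the power series Σ a_i t^i (a_0 = 1):
-- g_0 = 1 and Σ_{i=0}^{n} a_i g_{n-i} = 0 for n ≥ 1.
-- Defined via the list g_n, g_{n-1}, …, g_0 to get structural recursion.
-- gTab n m = g_m whenever m ≤ n (a growing lookup table).
gTab : ℕ → (ℕ → ℚ)
gTab zero m = 1ℚ
gTab (suc n) m =
  if m ℕ.≤ᵇ n then gTab n m
  else - sumTo n (λ i → logCoeff (suc i) * gTab n (n ∸ i))

gregoryCoeff : ℕ → ℚ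
gregoryCoeff n = gTab n n

binomℚ : ℚ → ℕ → ℚ
binomℚ x zero = 1ℚ
binomℚ x (suc m) = binomℚ x m * ((x - ℕ→ℚ m) * (+ 1 ℚ./ suc m))

-- Gregory polynomial: coefficient of t^n in (t/log(1+t)) · (1+t)^x
--   = Σ_{m=0}^{n} g_{n-m} binom(x,m)
gregoryPoly : ℕ → ℚ → ℚ
gregoryPoly n x = sumTo n (λ m → gregoryCoeff (n ∸ m) * binomℚ x m)

-- Families indexed by primes p (elements of Π_p Q, meant to be reduced mod p)
Family : Set
Family = ℕ → ℚ

-- "q ≡ 0 mod p" for a rational q: p divides the numerator of q in lowest terms
-- (equivalently v_p(q) ≥ 1, so q is p-integral and reduces to 0 mod p).
≡0mod : ℕ → ℚ → Set
≡0mod p q = p ∣ ℤ.∣ ↥ q ∣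

-- Equality in 𝒜 = (Π_p Z/p)/(⊕_p Z/p): the components agree mod p
-- for all but finitely many primes p.
_≈𝒜_ : Family → Family → Set
a ≈𝒜 b = ∃ λ N → ∀ p → Prime p → N < p → ≡0mod p (a p - b p)

G𝒜 : ℕ → ℚ → Family
G𝒜 k x p = gregoryPoly (p ∸ k) x

ℓ𝒜 : ℚ → Family
ℓ𝒜 x zero = 0ℚ   -- p = 0 is never prime; junk value
ℓ𝒜 x p@(suc _) = ((x ^ℚ p) - x) * (+ 1 ℚ./ p)

{-# OPTIONS --safe #-}

-- Let Δ be the forward difference. On polynomials log (1 + Δ) is differentiation, so the
-- coefficients a_i of log (1 + t) / t satisfy Σ_{i ≤ n} a_i Δ^(p-n+i) (y^p / p) = Δ^(p-n-1) y^(p-1)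
-- exactly, the omitted terms having order larger than p. Modulo p, the function y^(p-1) is
-- 1 - binom (y - 1, p - 1), whose differences are given by Pascal's rule. Hence
-- H_n = - Δ^(p-n) ℓ (x + 1) satisfies Σ_i a_i H_(n-i) ≡ binom (x, n), the recursion that
-- determines the Gregory polynomials G_n (x).

module Submission where

open import Defs
open import Data.Nat as ℕ using (ℕ; zero; suc; _≤_; _<_; _∸_; _+_; z≤n; s≤s)
import Data.Nat.Properties as ℕₚ
open import Data.Nat.Combinatorics
  using (_C_; nCn≡1; k>n⇒nCk≡0; nCk≡n!/k![n-k]!; k![n∸k]!∣n!; nCk+nC[k+1]≡[n+1]C[k+1])
open import Data.Nat.Divisibility as Div using (_∣_)
open import Data.Nat.DivMod using (m/n*n≡m)
open import Data.Nat.Primality using (Prime; euclidsLemma; prime⇒nonZero; ¬prime[0]; ¬prime[1])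
open import Data.Integer as ℤ using (ℤ)
import Data.Integer.DivMod as ℤ÷
import Data.Integer.Properties as ℤₚ
open import Data.Rational as ℚ using (ℚ; _*_; 0ℚ; 1ℚ; _-_; -_)
import Data.Rational.Properties as ℚₚ
open import Data.Rational.Solver using (module +-*-Solver)
open import Data.Rational.Unnormalised.Base as ℚᵘ using (mkℚᵘ)
import Data.Rational.Unnormalised.Properties as ℚᵘₚ
open import Data.Bool using (if_then_else_)
open import Data.Bool.Properties using (T-≡; ¬-not)
open import Data.Product using (∃; _×_; _,_)
open import Data.Sum using (inj₁; inj₂; [_,_]′)
open import Function.Base using (id)
open import Function.Bundles using (Equivalence)
open import Relation.Nullary using (¬_; contradiction)
open import Relation.Binary.PropositionalEquality
open ≡-Reasoning
open +-*-Solver using (solve; _:+_; _:*_; _:-_; :-_; _:=_; con)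

-- Embedding of the integers into the rationals

-- Since ℓ divides by p, a congruence modulo p for y^p says nothing about it. The relation with log
-- (1 + Δ) is therefore proved as an identity of rational numbers, where the factor p produced by
-- differentiating y^p cancels the 1/p, and reduction modulo p starts only with y^(p-1).
-- Differentiation is obtained from the commutator of log (1 + Δ) with multiplication by the
-- variable, which telescopes and leaves one explicit truncation error. The range n ≤ p - 2 has two
-- sources. The first coefficient of log (1 + t) / t that is not p-integral is a_(p-1), equal to 1/p
-- up to sign. Also, only differences of order p - n ≥ 2 kill the linear term -y/p of ℓ. For n = p -
-- k both amount to k ≥ 2.

fromℚᵘ-homo-+ : ∀ u v → ℚ.fromℚᵘ (u ℚᵘ.+ v) ≡ ℚ.fromℚᵘ u ℚ.+ ℚ.fromℚᵘ v
fromℚᵘ-homo-+ u v = ℚₚ.toℚᵘ-injective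
  (ℚᵘₚ.≃-trans (ℚₚ.toℚᵘ-fromℚᵘ (u ℚᵘ.+ v))
  (ℚᵘₚ.≃-sym (ℚᵘₚ.≃-trans (ℚₚ.toℚᵘ-homo-+ (ℚ.fromℚᵘ u) (ℚ.fromℚᵘ v))
     (ℚᵘₚ.+-cong (ℚₚ.toℚᵘ-fromℚᵘ u) (ℚₚ.toℚᵘ-fromℚᵘ v)))))

fromℚᵘ-homo-* : ∀ u v → ℚ.fromℚᵘ (u ℚᵘ.* v) ≡ ℚ.fromℚᵘ u * ℚ.fromℚᵘ v
fromℚᵘ-homo-* u v = ℚₚ.toℚᵘ-injective
  (ℚᵘₚ.≃-trans (ℚₚ.toℚᵘ-fromℚᵘ (u ℚᵘ.* v))
  (ℚᵘₚ.≃-sym (ℚᵘₚ.≃-trans (ℚₚ.toℚᵘ-homo-* (ℚ.fromℚᵘ u) (ℚ.fromℚᵘ v))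
     (ℚᵘₚ.*-cong (ℚₚ.toℚᵘ-fromℚᵘ u) (ℚₚ.toℚᵘ-fromℚᵘ v)))))

ℤ→ℚ : ℤ → ℚ
ℤ→ℚ n = n ℚ./ 1

ℤ→ℚ-+ : ∀ m n → ℤ→ℚ (m ℤ.+ n) ≡ ℤ→ℚ m ℚ.+ ℤ→ℚ n
ℤ→ℚ-+ m n = trans
  (cong ℤ→ℚ (sym (cong₂ ℤ._+_ (ℤₚ.*-identityʳ m) (ℤₚ.*-identityʳ n))))
  (fromℚᵘ-homo-+ (mkℚᵘ m 0) (mkℚᵘ n 0))

ℤ→ℚ-* : ∀ m n → ℤ→ℚ (m ℤ.* n) ≡ ℤ→ℚ m * ℤ→ℚ n
ℤ→ℚ-* m n = fromℚᵘ-homo-* (mkℚᵘ m 0) (mkℚᵘ n 0)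

ℤ→ℚ-neg : ∀ n → ℤ→ℚ (ℤ.- n) ≡ - ℤ→ℚ n
ℤ→ℚ-neg (ℤ.+ zero)  = refl
ℤ→ℚ-neg (ℤ.+ suc n) = refl
ℤ→ℚ-neg (ℤ.-[1+ n ]) = solve 1 (λ a → a := :- (:- a)) refl _

ℤ→ℚ-injective : ∀ {m n} → ℤ→ℚ m ≡ ℤ→ℚ n → m ≡ n
ℤ→ℚ-injective {m} {n} eq = trans (sym (ℤₚ.*-identityʳ m))
  (trans (ℚᵘₚ.drop-*≡* (ℚₚ.fromℚᵘ-injective {mkℚᵘ m 0} {mkℚᵘ n 0} eq)) (ℤₚ.*-identityʳ n))

ℕ→ℚ-+ : ∀ m n → ℕ→ℚ (m + n) ≡ ℕ→ℚ m ℚ.+ ℕ→ℚ n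
ℕ→ℚ-+ m n = ℤ→ℚ-+ (ℤ.+ m) (ℤ.+ n)

ℕ→ℚ-* : ∀ m n → ℕ→ℚ (m ℕ.* n) ≡ ℕ→ℚ m * ℕ→ℚ n
ℕ→ℚ-* m n = trans (cong ℤ→ℚ (ℤₚ.pos-* m n)) (ℤ→ℚ-* (ℤ.+ m) (ℤ.+ n))

ℕ→ℚ-^ : ∀ m n → ℕ→ℚ (m ℕ.^ n) ≡ ℕ→ℚ m ^ℚ n
ℕ→ℚ-^ m zero    = refl
ℕ→ℚ-^ m (suc n) = trans (ℕ→ℚ-* m (m ℕ.^ n)) (cong (ℕ→ℚ m *_) (ℕ→ℚ-^ m n))

ℕ→ℚ-suc : ∀ m → ℕ→ℚ (suc m) ≡ 1ℚ ℚ.+ ℕ→ℚ m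
ℕ→ℚ-suc m = ℕ→ℚ-+ 1 m

-- The shifted index makes the denominator nonzero by construction and agrees definitionally with
-- the fractions in `logCoeff`, `binomℚ` and `ℓ𝒜`.
recip : ℕ → ℚ
recip m = ℤ.+ 1 ℚ./ suc m

recip-inverse : ∀ m → ℕ→ℚ (suc m) * recip m ≡ 1ℚ
recip-inverse m = trans (sym (fromℚᵘ-homo-* (mkℚᵘ (ℤ.+ suc m) 0) (mkℚᵘ (ℤ.+ 1) m)))
  (ℚₚ.fromℚᵘ-cong {mkℚᵘ (ℤ.+ suc m) 0 ℚᵘ.* mkℚᵘ (ℤ.+ 1) m} {mkℚᵘ (ℤ.+ 1) 0}
    (ℚᵘ.*≡* (trans (ℤₚ.*-identityʳ _) (trans (ℤₚ.*-identityʳ _)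
      (sym (trans (ℤₚ.*-identityˡ _) (cong ℤ.+_ (ℕₚ.+-identityʳ (suc m)))))))))

↧-clear : ∀ x → x * ℤ→ℚ (ℚ.↧ x) ≡ ℤ→ℚ (ℚ.↥ x)
↧-clear x@(ℚ.mkℚ n d c) = trans (cong (_* ℤ→ℚ (ℤ.+ suc d)) (sym (ℚₚ.fromℚᵘ-toℚᵘ x)))
  (trans (sym (fromℚᵘ-homo-* (mkℚᵘ n d) (mkℚᵘ (ℤ.+ suc d) 0)))
   (ℚₚ.fromℚᵘ-cong {mkℚᵘ n d ℚᵘ.* mkℚᵘ (ℤ.+ suc d) 0} {mkℚᵘ n 0}
     (ℚᵘ.*≡* (trans (ℤₚ.*-identityʳ _) (cong (λ t → n ℤ.* (ℤ.+ t)) (sym (ℕₚ.*-identityʳ (suc d))))))))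

-- Finite sums and Cauchy products

sumTo-cong : ∀ n {f g} → (∀ i → i ≤ n → f i ≡ g i) → sumTo n f ≡ sumTo n g
sumTo-cong zero    h = h 0 z≤n
sumTo-cong (suc n) h = cong₂ ℚ._+_ (sumTo-cong n (λ i i≤n → h i (ℕₚ.m≤n⇒m≤1+n i≤n))) (h (suc n) ℕₚ.≤-refl)

sumTo-+ : ∀ n f g → sumTo n (λ i → f i ℚ.+ g i) ≡ sumTo n f ℚ.+ sumTo n g
sumTo-+ zero    f g = refl
sumTo-+ (suc n) f g = trans (cong (ℚ._+ (f (suc n) ℚ.+ g (suc n))) (sumTo-+ n f g))
  (solve 4 (λ a b c d → (a :+ b) :+ (c :+ d) := (a :+ c) :+ (b :+ d)) refl
    (sumTo n f) (sumTo n g) (f (suc n)) (g (suc n)))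

sumTo-*ˡ : ∀ n c f → sumTo n (λ i → c * f i) ≡ c * sumTo n f
sumTo-*ˡ zero    c f = refl
sumTo-*ˡ (suc n) c f = trans (cong (ℚ._+ c * f (suc n)) (sumTo-*ˡ n c f))
  (sym (ℚₚ.*-distribˡ-+ c (sumTo n f) (f (suc n))))

sumTo-0 : ∀ n f → (∀ i → f i ≡ 0ℚ) → sumTo n f ≡ 0ℚ
sumTo-0 zero    f h = h 0
sumTo-0 (suc n) f h = cong₂ ℚ._+_ (sumTo-0 n f h) (h (suc n))

sumTo-front : ∀ n f → sumTo (suc n) f ≡ f 0 ℚ.+ sumTo n (λ i → f (suc i))
sumTo-front zero    f = refl
sumTo-front (suc n) f = trans (cong (ℚ._+ f (suc (suc n))) (sumTo-front n f))
  (ℚₚ.+-assoc (f 0) (sumTo n (λ i → f (suc i))) (f (suc (suc n))))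

sumTo-reverse : ∀ n f → sumTo n f ≡ sumTo n (λ i → f (n ∸ i))
sumTo-reverse zero    f = refl
sumTo-reverse (suc n) f = begin
  sumTo n f ℚ.+ f (suc n)                     ≡⟨ cong (ℚ._+ f (suc n)) (sumTo-reverse n f) ⟩
  sumTo n (λ i → f (n ∸ i)) ℚ.+ f (suc n)     ≡⟨ ℚₚ.+-comm (sumTo n (λ i → f (n ∸ i))) (f (suc n)) ⟩
  f (suc n) ℚ.+ sumTo n (λ i → f (n ∸ i))     ≡⟨ sumTo-front n (λ i → f (suc n ∸ i)) ⟨
  sumTo (suc n) (λ i → f (suc n ∸ i))         ∎

infixl 7 _⊛_
-- Coefficients of a product of generating functions, indexed so that `gregoryPoly n x` is
-- `(gregoryCoeff ⊛ binomℚ x) n` by definition.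
_⊛_ : (ℕ → ℚ) → (ℕ → ℚ) → ℕ → ℚ
(f ⊛ g) n = sumTo n (λ m → f (n ∸ m) * g m)

-- Only the last term contains `f 0`. Splitting it off shifts the first series and leaves the second
-- alone, which is the form that induction on the index needs.
⊛-suc : ∀ f g n → (f ⊛ g) (suc n) ≡ ((λ i → f (suc i)) ⊛ g) n ℚ.+ f 0 * g (suc n)
⊛-suc f g n = cong₂ ℚ._+_
  (sumTo-cong n (λ i i≤n → cong (λ t → f t * g i) (ℕₚ.+-∸-assoc 1 i≤n)))
  (cong (λ t → f t * g (suc n)) (ℕₚ.n∸n≡0 n))

⊛-congˡ : ∀ {f f′} g n → (∀ i → f i ≡ f′ i) → (f ⊛ g) n ≡ (f′ ⊛ g) n
⊛-congˡ g n h = sumTo-cong n (λ i _ → cong (_* g i) (h (n ∸ i)))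

⊛-distribʳ : ∀ f f′ g c n →
  ((λ i → f i ℚ.+ c * f′ i) ⊛ g) n ≡ (f ⊛ g) n ℚ.+ c * (f′ ⊛ g) n
⊛-distribʳ f f′ g c n = begin
  sumTo n (λ m → (f (n ∸ m) ℚ.+ c * f′ (n ∸ m)) * g m)
    ≡⟨ sumTo-cong n (λ m _ → solve 4 (λ a b c d → (a :+ c :* b) :* d := a :* d :+ c :* (b :* d)) refl
         (f (n ∸ m)) (f′ (n ∸ m)) c (g m)) ⟩
  sumTo n (λ m → f (n ∸ m) * g m ℚ.+ c * (f′ (n ∸ m) * g m))
    ≡⟨ sumTo-+ n _ _ ⟩
  (f ⊛ g) n ℚ.+ sumTo n (λ m → c * (f′ (n ∸ m) * g m))
    ≡⟨ cong ((f ⊛ g) n ℚ.+_) (sumTo-*ˡ n c _) ⟩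
  (f ⊛ g) n ℚ.+ c * (f′ ⊛ g) n ∎

-- Induction on `n` for varying `f`: constant terms are peeled off by `⊛-suc`, so no double sum has
-- to be interchanged.
⊛-assoc : ∀ f g h n → (f ⊛ (g ⊛ h)) n ≡ ((f ⊛ g) ⊛ h) n
⊛-assoc f g h zero    = sym (ℚₚ.*-assoc (f 0) (g 0) (h 0))
⊛-assoc f g h (suc n) = begin
  (f ⊛ (g ⊛ h)) (suc n)
    ≡⟨ ⊛-suc f (g ⊛ h) n ⟩
  (f′ ⊛ (g ⊛ h)) n ℚ.+ f 0 * (g ⊛ h) (suc n)
    ≡⟨ cong₂ (λ a b → a ℚ.+ f 0 * b) (⊛-assoc f′ g h n) (⊛-suc g h n) ⟩
  ((f′ ⊛ g) ⊛ h) n ℚ.+ f 0 * ((g′ ⊛ h) n ℚ.+ g 0 * h (suc n))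
    ≡⟨ solve 5 (λ a b c d e → a :+ b :* (c :+ d :* e) := (a :+ b :* c) :+ (b :* d) :* e) refl
         (((f′ ⊛ g) ⊛ h) n) (f 0) ((g′ ⊛ h) n) (g 0) (h (suc n)) ⟩
  (((f′ ⊛ g) ⊛ h) n ℚ.+ f 0 * (g′ ⊛ h) n) ℚ.+ (f 0 * g 0) * h (suc n)
    ≡⟨ cong (ℚ._+ (f 0 * g 0) * h (suc n)) (⊛-distribʳ (f′ ⊛ g) g′ h (f 0) n) ⟨
  ((λ i → (f′ ⊛ g) i ℚ.+ f 0 * g′ i) ⊛ h) n ℚ.+ (f 0 * g 0) * h (suc n)
    ≡⟨ cong (ℚ._+ (f 0 * g 0) * h (suc n)) (⊛-congˡ h n (⊛-suc f g)) ⟨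
  ((λ i → (f ⊛ g) (suc i)) ⊛ h) n ℚ.+ (f 0 * g 0) * h (suc n)
    ≡⟨ ⊛-suc (f ⊛ g) h n ⟨
  ((f ⊛ g) ⊛ h) (suc n) ∎
  where
  f′ g′ : ℕ → ℚ
  f′ i = f (suc i)
  g′ i = g (suc i)

binomialSum : ℕ → (ℕ → ℚ) → ℚ
binomialSum n f = sumTo n (λ j → ℕ→ℚ (n C j) * f j)

-- With E the shift of the index, `binomialSum n` is (1 + E)^n evaluated at 0, and Pascal's rule
-- supplies one more factor 1 + E. The binomial theorem and the alternating form of `Δ^` both rest
-- on this.
binomialSum-suc : ∀ n f → binomialSum (suc n) f ≡ binomialSum n f ℚ.+ binomialSum n (λ j → f (suc j))
binomialSum-suc n f = begin
  sumTo (suc n) (λ j → ℕ→ℚ (suc n C j) * f j)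
    ≡⟨ sumTo-front n _ ⟩
  f₀ ℚ.+ sumTo n (λ j → ℕ→ℚ (suc n C suc j) * f (suc j))
    ≡⟨ cong (f₀ ℚ.+_) (sumTo-cong n (λ j _ → pascal j)) ⟩
  f₀ ℚ.+ sumTo n (λ j → ℕ→ℚ (n C j) * f (suc j) ℚ.+ ℕ→ℚ (n C suc j) * f (suc j))
    ≡⟨ cong (f₀ ℚ.+_) (sumTo-+ n _ _) ⟩
  f₀ ℚ.+ (binomialSum n (λ j → f (suc j)) ℚ.+ sumTo n (λ j → ℕ→ℚ (n C suc j) * f (suc j)))
    ≡⟨ solve 3 (λ a b c → a :+ (b :+ c) := (a :+ c) :+ b) refl f₀ _ _ ⟩
  (f₀ ℚ.+ sumTo n (λ j → ℕ→ℚ (n C suc j) * f (suc j))) ℚ.+ binomialSum n (λ j → f (suc j))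
    ≡⟨ cong (ℚ._+ binomialSum n (λ j → f (suc j))) (sumTo-front n (λ j → ℕ→ℚ (n C j) * f j)) ⟨
  sumTo (suc n) (λ j → ℕ→ℚ (n C j) * f j) ℚ.+ binomialSum n (λ j → f (suc j))
    ≡⟨ cong (ℚ._+ binomialSum n (λ j → f (suc j))) top ⟩
  binomialSum n f ℚ.+ binomialSum n (λ j → f (suc j)) ∎
  where
  f₀ : ℚ
  f₀ = 1ℚ * f 0
  pascal : ∀ j → ℕ→ℚ (suc n C suc j) * f (suc j) ≡
                 ℕ→ℚ (n C j) * f (suc j) ℚ.+ ℕ→ℚ (n C suc j) * f (suc j)
  pascal j = begin
    ℕ→ℚ (suc n C suc j) * f (suc j)
      ≡⟨ cong (λ t → ℕ→ℚ t * f (suc j)) (nCk+nC[k+1]≡[n+1]C[k+1] n j) ⟨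
    ℕ→ℚ (n C j + n C suc j) * f (suc j)
      ≡⟨ cong (_* f (suc j)) (ℕ→ℚ-+ (n C j) (n C suc j)) ⟩
    (ℕ→ℚ (n C j) ℚ.+ ℕ→ℚ (n C suc j)) * f (suc j)
      ≡⟨ ℚₚ.*-distribʳ-+ (f (suc j)) (ℕ→ℚ (n C j)) _ ⟩
    ℕ→ℚ (n C j) * f (suc j) ℚ.+ ℕ→ℚ (n C suc j) * f (suc j) ∎
  top : sumTo (suc n) (λ j → ℕ→ℚ (n C j) * f j) ≡ binomialSum n f
  top = begin
    binomialSum n f ℚ.+ ℕ→ℚ (n C suc n) * f (suc n)
      ≡⟨ cong (λ t → binomialSum n f ℚ.+ ℕ→ℚ t * f (suc n)) (k>n⇒nCk≡0 (ℕₚ.n<1+n n)) ⟩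
    binomialSum n f ℚ.+ 0ℚ * f (suc n)
      ≡⟨ solve 2 (λ a b → a :+ con 0ℚ :* b := a) refl (binomialSum n f) (f (suc n)) ⟩
    binomialSum n f ∎

binomial-theorem : ∀ y n → (1ℚ ℚ.+ y) ^ℚ n ≡ binomialSum n (y ^ℚ_)
binomial-theorem y zero    = refl
binomial-theorem y (suc n) = begin
  (1ℚ ℚ.+ y) * ((1ℚ ℚ.+ y) ^ℚ n)                        ≡⟨ cong ((1ℚ ℚ.+ y) *_) (binomial-theorem y n) ⟩
  (1ℚ ℚ.+ y) * b                                        ≡⟨ solve 2 (λ y b → (con 1ℚ :+ y) :* b := b :+ y :* b) refl y b ⟩
  b ℚ.+ y * b                                           ≡⟨ cong (b ℚ.+_) (sumTo-*ˡ n y _) ⟨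
  b ℚ.+ sumTo n (λ j → y * (ℕ→ℚ (n C j) * (y ^ℚ j)))
    ≡⟨ cong (b ℚ.+_) (sumTo-cong n (λ j _ →
         solve 3 (λ a c d → a :* (c :* d) := c :* (a :* d)) refl y (ℕ→ℚ (n C j)) (y ^ℚ j))) ⟩
  b ℚ.+ binomialSum n (λ j → y ^ℚ suc j)                ≡⟨ binomialSum-suc n (y ^ℚ_) ⟨
  binomialSum (suc n) (y ^ℚ_)                           ∎
  where
  b : ℚ
  b = binomialSum n (y ^ℚ_)

-- Forward differences

Δ^ : ℕ → (ℚ → ℚ) → ℚ → ℚ
Δ^ zero    f y = f y
Δ^ (suc k) f y = Δ^ k f (y ℚ.+ 1ℚ) - Δ^ k f y

Δ^-cong : ∀ k {f g} → (∀ y → f y ≡ g y) → ∀ y → Δ^ k f y ≡ Δ^ k g y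
Δ^-cong zero    h y = h y
Δ^-cong (suc k) h y = cong₂ _-_ (Δ^-cong k h (y ℚ.+ 1ℚ)) (Δ^-cong k h y)

Δ^-linear : ∀ k c d f g y → Δ^ k (λ z → c * f z ℚ.+ d * g z) y ≡ c * Δ^ k f y ℚ.+ d * Δ^ k g y
Δ^-linear zero    c d f g y = refl
Δ^-linear (suc k) c d f g y =
  trans (cong₂ _-_ (Δ^-linear k c d f g (y ℚ.+ 1ℚ)) (Δ^-linear k c d f g y))
    (solve 6 (λ c d a b a′ b′ → (c :* a :+ d :* b) :- (c :* a′ :+ d :* b′) := c :* (a :- a′) :+ d :* (b :- b′)) refl
      c d (Δ^ k f (y ℚ.+ 1ℚ)) (Δ^ k g (y ℚ.+ 1ℚ)) (Δ^ k f y) (Δ^ k g y))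

Δ^-const : ∀ k c y → Δ^ (suc k) (λ _ → c) y ≡ 0ℚ
Δ^-const zero    c y = ℚₚ.+-inverseʳ c
Δ^-const (suc k) c y = cong₂ _-_ (Δ^-const k c (y ℚ.+ 1ℚ)) (Δ^-const k c y)

-- Leibniz rule: the commutator of Δ^(j+1) with multiplication by the variable is (j + 1) E Δ^j,
-- with shift E = 1 + Δ. The shift is expanded so that every term sits at `y`, which makes the sum
-- in `logΔ-id*` telescope.
Δ^-id* : ∀ j g y → Δ^ (suc j) (λ z → z * g z) y ≡
  y * Δ^ (suc j) g y ℚ.+ ℕ→ℚ (suc j) * (Δ^ j g y ℚ.+ Δ^ (suc j) g y)
Δ^-id* zero    g y = solve 3 (λ y a b →
  (y :+ con 1ℚ) :* a :- y :* b := y :* (a :- b) :+ con 1ℚ :* (b :+ (a :- b))) refl y (g (y ℚ.+ 1ℚ)) (g y)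
Δ^-id* (suc j) g y = begin
  Δ^ (suc j) (λ z → z * g z) (y ℚ.+ 1ℚ) - Δ^ (suc j) (λ z → z * g z) y
    ≡⟨ cong₂ _-_ (Δ^-id* j g (y ℚ.+ 1ℚ)) (Δ^-id* j g y) ⟩
  ((y ℚ.+ 1ℚ) * (c - b) ℚ.+ s * (b ℚ.+ (c - b))) - (y * (b - a) ℚ.+ s * (a ℚ.+ (b - a)))
    ≡⟨ solve 5 (λ y a b c s → ((y :+ con 1ℚ) :* (c :- b) :+ s :* (b :+ (c :- b))) :- (y :* (b :- a) :+ s :* (a :+ (b :- a)))
          := y :* ((c :- b) :- (b :- a)) :+ (con 1ℚ :+ s) :* ((b :- a) :+ ((c :- b) :- (b :- a)))) refl y a b c s ⟩
  y * Δ^ (suc (suc j)) g y ℚ.+ (1ℚ ℚ.+ s) * (Δ^ (suc j) g y ℚ.+ Δ^ (suc (suc j)) g y)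
    ≡⟨ cong (λ t → y * Δ^ (suc (suc j)) g y ℚ.+ t * (Δ^ (suc j) g y ℚ.+ Δ^ (suc (suc j)) g y)) (ℕ→ℚ-suc (suc j)) ⟨
  y * Δ^ (suc (suc j)) g y ℚ.+ ℕ→ℚ (suc (suc j)) * (Δ^ (suc j) g y ℚ.+ Δ^ (suc (suc j)) g y) ∎
  where
  a b c s : ℚ
  a = Δ^ j g y
  b = Δ^ j g (y ℚ.+ 1ℚ)
  c = Δ^ j g (y ℚ.+ 1ℚ ℚ.+ 1ℚ)
  s = ℕ→ℚ (suc j)

Δ^-pow≡0 : ∀ {j m} → m < j → ∀ y → Δ^ j (_^ℚ m) y ≡ 0ℚ
Δ^-pow≡0 {suc j} {zero}  _         y = Δ^-const j 1ℚ y
Δ^-pow≡0 {suc j} {suc m} (s≤s m<j) y = begin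
  Δ^ (suc j) (λ z → z * (z ^ℚ m)) y
    ≡⟨ Δ^-id* j (_^ℚ m) y ⟩
  y * Δ^ (suc j) (_^ℚ m) y ℚ.+ ℕ→ℚ (suc j) * (Δ^ j (_^ℚ m) y ℚ.+ Δ^ (suc j) (_^ℚ m) y)
    ≡⟨ cong₂ (λ a b → y * a ℚ.+ ℕ→ℚ (suc j) * (b ℚ.+ a)) (Δ^-pow≡0 (ℕₚ.m<n⇒m<1+n m<j) y) (Δ^-pow≡0 m<j y) ⟩
  y * 0ℚ ℚ.+ ℕ→ℚ (suc j) * 0ℚ
    ≡⟨ solve 2 (λ y s → y :* con 0ℚ :+ s :* con 0ℚ := con 0ℚ) refl y (ℕ→ℚ (suc j)) ⟩
  0ℚ ∎

-- Expansion of (1 - E)^k = (-1)^k Δ^k. The sign is (-1)^j rather than (-1)^(k-j), whence the factor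
-- `sgn k`.
alternatingSum : ∀ k f y →
  sumTo k (λ j → (sgn j * ℕ→ℚ (k C j)) * f (y ℚ.+ ℕ→ℚ j)) ≡ sgn k * Δ^ k f y
alternatingSum k f y = trans
  (sumTo-cong k (λ j _ → solve 3 (λ a b c → (a :* b) :* c := b :* (a :* c)) refl (sgn j) (ℕ→ℚ (k C j)) _))
  (go k y)
  where
  go : ∀ k y → binomialSum k (λ j → sgn j * f (y ℚ.+ ℕ→ℚ j)) ≡ sgn k * Δ^ k f y
  go zero    y = trans (ℚₚ.*-identityˡ _) (cong (λ t → 1ℚ * f t) (ℚₚ.+-identityʳ y))
  go (suc k) y = begin
    binomialSum (suc k) F
      ≡⟨ binomialSum-suc k F ⟩
    binomialSum k F ℚ.+ binomialSum k (λ j → F (suc j))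
      ≡⟨ cong (binomialSum k F ℚ.+_) (sumTo-cong k (λ j _ → shift j)) ⟩
    binomialSum k F ℚ.+ sumTo k (λ j → (- 1ℚ) * (ℕ→ℚ (k C j) * (sgn j * f (y ℚ.+ 1ℚ ℚ.+ ℕ→ℚ j))))
      ≡⟨ cong₂ ℚ._+_ (go k y) (trans (sumTo-*ˡ k (- 1ℚ) _) (cong ((- 1ℚ) *_) (go k (y ℚ.+ 1ℚ)))) ⟩
    sgn k * Δ^ k f y ℚ.+ (- 1ℚ) * (sgn k * Δ^ k f (y ℚ.+ 1ℚ))
      ≡⟨ solve 3 (λ s a b → s :* a :+ (:- con 1ℚ) :* (s :* b) := (:- s) :* (b :- a)) refl
           (sgn k) (Δ^ k f y) (Δ^ k f (y ℚ.+ 1ℚ)) ⟩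
    sgn (suc k) * Δ^ (suc k) f y ∎
    where
    F : ℕ → ℚ
    F j = sgn j * f (y ℚ.+ ℕ→ℚ j)
    shift : ∀ j → ℕ→ℚ (k C j) * F (suc j) ≡ (- 1ℚ) * (ℕ→ℚ (k C j) * (sgn j * f (y ℚ.+ 1ℚ ℚ.+ ℕ→ℚ j)))
    shift j = trans
      (cong (λ t → ℕ→ℚ (k C j) * ((- sgn j) * f t)) (trans (cong (y ℚ.+_) (ℕ→ℚ-suc j)) (sym (ℚₚ.+-assoc y 1ℚ (ℕ→ℚ j)))))
      (solve 3 (λ a s b → a :* ((:- s) :* b) := (:- con 1ℚ) :* (a :* (s :* b))) refl (ℕ→ℚ (k C j)) (sgn j) _)

sgn² : ∀ k → sgn k * sgn k ≡ 1ℚ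
sgn² zero    = refl
sgn² (suc k) = trans (solve 1 (λ s → (:- s) :* (:- s) := s :* s) refl (sgn k)) (sgn² k)

-- The logarithm of the shift operator

-- The operator Δ^k log (1 + Δ), with the series of the logarithm cut off after index `n`.
logΔ : ℕ → ℕ → (ℚ → ℚ) → ℚ → ℚ
logΔ n k f y = sumTo n (λ i → logCoeff i * Δ^ (suc k + i) f y)

logCoeff-* : ∀ n → logCoeff n * ℕ→ℚ (suc n) ≡ sgn n
logCoeff-* n = begin
  (sgn n * recip n) * ℕ→ℚ (suc n)   ≡⟨ solve 3 (λ a b c → (a :* b) :* c := a :* (c :* b)) refl (sgn n) (recip n) (ℕ→ℚ (suc n)) ⟩
  sgn n * (ℕ→ℚ (suc n) * recip n)   ≡⟨ cong (sgn n *_) (recip-inverse n) ⟩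
  sgn n * 1ℚ                        ≡⟨ ℚₚ.*-identityʳ (sgn n) ⟩
  sgn n                             ∎

-- The commutator of log (1 + Δ) with multiplication by the variable is 1. By `Δ^-id*` the term of
-- index i contributes (-1)^i (Δ^i + Δ^(i+1)), because a_i (i + 1) = (-1)^i. These contributions
-- telescope to 1 plus the truncation error (-1)^n Δ^(n+1).
logΔ-id* : ∀ n g y → logΔ n 0 (λ z → z * g z) y ≡
  y * logΔ n 0 g y ℚ.+ g y ℚ.+ sgn n * Δ^ (suc n) g y
logΔ-id* zero    g y = solve 3 (λ y a b → (con 1ℚ :* con 1ℚ) :* ((y :+ con 1ℚ) :* a :- y :* b)
    := y :* ((con 1ℚ :* con 1ℚ) :* (a :- b)) :+ b :+ con 1ℚ :* (a :- b)) refl y (g (y ℚ.+ 1ℚ)) (g y)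
logΔ-id* (suc n) g y = begin
  logΔ n 0 (λ z → z * g z) y ℚ.+ a * Δ^ (suc (suc n)) (λ z → z * g z) y
    ≡⟨ cong₂ (λ u v → u ℚ.+ a * v) (logΔ-id* n g y) (Δ^-id* (suc n) g y) ⟩
  (y * l ℚ.+ g y ℚ.+ sgn n * d₁) ℚ.+ a * (y * d₂ ℚ.+ ℕ→ℚ (suc (suc n)) * (d₁ ℚ.+ d₂))
    ≡⟨ solve 8 (λ y l g s d₁ a d₂ t → (y :* l :+ g :+ s :* d₁) :+ a :* (y :* d₂ :+ t :* (d₁ :+ d₂))
          := (y :* (l :+ a :* d₂) :+ g :+ s :* d₁) :+ (a :* t) :* (d₁ :+ d₂)) refl
         y l (g y) (sgn n) d₁ a d₂ (ℕ→ℚ (suc (suc n))) ⟩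
  (y * (l ℚ.+ a * d₂) ℚ.+ g y ℚ.+ sgn n * d₁) ℚ.+ (a * ℕ→ℚ (suc (suc n))) * (d₁ ℚ.+ d₂)
    ≡⟨ cong (λ t → (y * (l ℚ.+ a * d₂) ℚ.+ g y ℚ.+ sgn n * d₁) ℚ.+ t * (d₁ ℚ.+ d₂)) (logCoeff-* (suc n)) ⟩
  (y * (l ℚ.+ a * d₂) ℚ.+ g y ℚ.+ sgn n * d₁) ℚ.+ (- sgn n) * (d₁ ℚ.+ d₂)
    ≡⟨ solve 4 (λ w s d₁ d₂ → (w :+ s :* d₁) :+ (:- s) :* (d₁ :+ d₂) := w :+ (:- s) :* d₂) refl
         (y * (l ℚ.+ a * d₂) ℚ.+ g y) (sgn n) d₁ d₂ ⟩
  y * (l ℚ.+ a * d₂) ℚ.+ g y ℚ.+ (- sgn n) * d₂ ∎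
  where
  a l d₁ d₂ : ℚ
  a  = logCoeff (suc n)
  l  = logΔ n 0 g y
  d₁ = Δ^ (suc n) g y
  d₂ = Δ^ (suc (suc n)) g y

-- The commutator relation is the product rule for z · z^m. Its truncation error is a difference of
-- order n + 1 of a power of degree at most n, hence zero.
logΔ-pow₀ : ∀ n m → m ≤ n → ∀ y → logΔ n 0 (_^ℚ suc m) y ≡ ℕ→ℚ (suc m) * (y ^ℚ m)
logΔ-pow₀ n zero m≤n y = begin
  logΔ n 0 (λ z → z * 1ℚ) y
    ≡⟨ logΔ-id* n (λ _ → 1ℚ) y ⟩
  y * logΔ n 0 (λ _ → 1ℚ) y ℚ.+ 1ℚ ℚ.+ sgn n * Δ^ (suc n) (λ _ → 1ℚ) y
    ≡⟨ cong₂ (λ a b → y * a ℚ.+ 1ℚ ℚ.+ sgn n * b)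
         (sumTo-0 n _ (λ i → trans (cong (logCoeff i *_) (Δ^-const i 1ℚ y)) (ℚₚ.*-zeroʳ (logCoeff i))))
         (Δ^-const n 1ℚ y) ⟩
  y * 0ℚ ℚ.+ 1ℚ ℚ.+ sgn n * 0ℚ
    ≡⟨ solve 2 (λ y s → y :* con 0ℚ :+ con 1ℚ :+ s :* con 0ℚ := con 1ℚ) refl y (sgn n) ⟩
  1ℚ ∎
logΔ-pow₀ n (suc m) m<n y = begin
  logΔ n 0 (λ z → z * (z ^ℚ suc m)) y
    ≡⟨ logΔ-id* n (_^ℚ suc m) y ⟩
  y * logΔ n 0 (_^ℚ suc m) y ℚ.+ (y ^ℚ suc m) ℚ.+ sgn n * Δ^ (suc n) (_^ℚ suc m) y
    ≡⟨ cong₂ (λ a b → y * a ℚ.+ (y ^ℚ suc m) ℚ.+ sgn n * b)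
         (logΔ-pow₀ n m (ℕₚ.<⇒≤ m<n) y) (Δ^-pow≡0 (s≤s m<n) y) ⟩
  y * (ℕ→ℚ (suc m) * (y ^ℚ m)) ℚ.+ y * (y ^ℚ m) ℚ.+ sgn n * 0ℚ
    ≡⟨ solve 4 (λ y a b s → y :* (a :* b) :+ y :* b :+ s :* con 0ℚ := (con 1ℚ :+ a) :* (y :* b)) refl
         y (ℕ→ℚ (suc m)) (y ^ℚ m) (sgn n) ⟩
  (1ℚ ℚ.+ ℕ→ℚ (suc m)) * (y ^ℚ suc m)
    ≡⟨ cong (_* (y ^ℚ suc m)) (ℕ→ℚ-suc (suc m)) ⟨
  ℕ→ℚ (suc (suc m)) * (y ^ℚ suc m) ∎

logΔ-suc : ∀ n k f y → logΔ n (suc k) f y ≡ logΔ n k f (y ℚ.+ 1ℚ) - logΔ n k f y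
logΔ-suc n k f y = begin
  sumTo n (λ i → logCoeff i * (Δ^ (suc k + i) f (y ℚ.+ 1ℚ) - Δ^ (suc k + i) f y))
    ≡⟨ sumTo-cong n (λ i _ → solve 3 (λ a b c → a :* (b :- c) := a :* b :+ (:- con 1ℚ) :* (a :* c)) refl
         (logCoeff i) (Δ^ (suc k + i) f (y ℚ.+ 1ℚ)) (Δ^ (suc k + i) f y)) ⟩
  sumTo n (λ i → logCoeff i * Δ^ (suc k + i) f (y ℚ.+ 1ℚ) ℚ.+ (- 1ℚ) * (logCoeff i * Δ^ (suc k + i) f y))
    ≡⟨ sumTo-+ n _ _ ⟩
  logΔ n k f (y ℚ.+ 1ℚ) ℚ.+ sumTo n (λ i → (- 1ℚ) * (logCoeff i * Δ^ (suc k + i) f y))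
    ≡⟨ cong (logΔ n k f (y ℚ.+ 1ℚ) ℚ.+_) (sumTo-*ˡ n (- 1ℚ) _) ⟩
  logΔ n k f (y ℚ.+ 1ℚ) ℚ.+ (- 1ℚ) * logΔ n k f y
    ≡⟨ solve 2 (λ a b → a :+ (:- con 1ℚ) :* b := a :- b) refl (logΔ n k f (y ℚ.+ 1ℚ)) (logΔ n k f y) ⟩
  logΔ n k f (y ℚ.+ 1ℚ) - logΔ n k f y ∎

-- log (1 + Δ) is differentiation, and the terms cut off at n vanish on powers of small degree.
logΔ-pow : ∀ k n m → m ≤ n + k → ∀ y → logΔ n k (_^ℚ suc m) y ≡ ℕ→ℚ (suc m) * Δ^ k (_^ℚ m) y
logΔ-pow zero    n m m≤ y = logΔ-pow₀ n m (subst (m ≤_) (ℕₚ.+-identityʳ n) m≤) y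
logΔ-pow (suc k) n m m≤ y = begin
  logΔ n (suc k) f y
    -- The next term of the series has order n + k + 3, above the degree m + 1, so it may be added.
    -- Raising the cutoff by one compensates for lowering `k` and keeps the bound on `m`.
    ≡⟨ solve 2 (λ a b → a := a :+ b :* con 0ℚ) refl (logΔ n (suc k) f y) (logCoeff (suc n)) ⟩
  logΔ n (suc k) f y ℚ.+ logCoeff (suc n) * 0ℚ
    ≡⟨ cong (λ t → logΔ n (suc k) f y ℚ.+ logCoeff (suc n) * t) (Δ^-pow≡0 top y) ⟨
  logΔ (suc n) (suc k) f y
    ≡⟨ logΔ-suc (suc n) k f y ⟩
  logΔ (suc n) k f (y ℚ.+ 1ℚ) - logΔ (suc n) k f y
    ≡⟨ cong₂ _-_ (logΔ-pow k (suc n) m m≤′ (y ℚ.+ 1ℚ)) (logΔ-pow k (suc n) m m≤′ y) ⟩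
  ℕ→ℚ (suc m) * Δ^ k (_^ℚ m) (y ℚ.+ 1ℚ) - ℕ→ℚ (suc m) * Δ^ k (_^ℚ m) y
    ≡⟨ solve 3 (λ a b c → a :* b :- a :* c := a :* (b :- c)) refl
         (ℕ→ℚ (suc m)) (Δ^ k (_^ℚ m) (y ℚ.+ 1ℚ)) (Δ^ k (_^ℚ m) y) ⟩
  ℕ→ℚ (suc m) * Δ^ (suc k) (_^ℚ m) y ∎
  where
  f : ℚ → ℚ
  f = _^ℚ suc m
  m≤′ : m ≤ suc n + k
  m≤′ = subst (m ≤_) (ℕₚ.+-suc n k) m≤
  top : suc m < suc (suc k) + suc n
  top = s≤s (s≤s (ℕₚ.≤-trans m≤′ (ℕₚ.≤-reflexive (trans (cong suc (ℕₚ.+-comm n k)) (sym (ℕₚ.+-suc k n))))))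

-- Gregory coefficients

gTab-stable : ∀ {n m} → m ≤ n → gTab n m ≡ gregoryCoeff m
gTab-stable {zero} z≤n = refl
gTab-stable {suc n} {m} m≤1+n with ℕₚ.m≤n⇒m<n∨m≡n m≤1+n
... | inj₂ refl      = refl
... | inj₁ (s≤s m≤n) = trans
  (cong (λ b → if b then gTab n m else - sumTo n (λ i → logCoeff (suc i) * gTab n (n ∸ i)))
    (Equivalence.to T-≡ (ℕₚ.≤⇒≤ᵇ m≤n)))
  (gTab-stable m≤n)

gregoryCoeff-suc : ∀ n → gregoryCoeff (suc n) ≡ - sumTo n (λ i → logCoeff (suc i) * gregoryCoeff (n ∸ i))
gregoryCoeff-suc n = trans
  (cong (λ b → if b then gTab n (suc n) else - sumTo n (λ i → logCoeff (suc i) * gTab n (n ∸ i)))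
    (¬-not (λ eq → ℕₚ.1+n≰n (ℕₚ.≤ᵇ⇒≤ (suc n) n (Equivalence.from T-≡ eq)))))
  (cong -_ (sumTo-cong n (λ i _ → cong (logCoeff (suc i) *_) (gTab-stable (ℕₚ.m∸n≤m n i)))))

-- The product of log (1 + t) / t and t / log (1 + t) is 1. The recursion for the Gregory
-- coefficients lists them in descending order, so the sum is reversed to match `⊛`.
logCoeff⊛gregoryCoeff-suc : ∀ n → (logCoeff ⊛ gregoryCoeff) (suc n) ≡ 0ℚ
logCoeff⊛gregoryCoeff-suc n = begin
  (logCoeff ⊛ gregoryCoeff) (suc n)
    ≡⟨ ⊛-suc logCoeff gregoryCoeff n ⟩
  ((λ i → logCoeff (suc i)) ⊛ gregoryCoeff) n ℚ.+ 1ℚ * gregoryCoeff (suc n)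
    ≡⟨ cong₂ (λ a b → a ℚ.+ 1ℚ * b) reversed (gregoryCoeff-suc n) ⟩
  s ℚ.+ 1ℚ * (- s)
    ≡⟨ solve 1 (λ s → s :+ con 1ℚ :* (:- s) := con 0ℚ) refl s ⟩
  0ℚ ∎
  where
  s : ℚ
  s = sumTo n (λ i → logCoeff (suc i) * gregoryCoeff (n ∸ i))
  reversed : ((λ i → logCoeff (suc i)) ⊛ gregoryCoeff) n ≡ s
  reversed = trans (sumTo-reverse n _)
    (sumTo-cong n (λ i i≤n → cong (λ t → logCoeff (suc t) * gregoryCoeff (n ∸ i)) (ℕₚ.m∸[m∸n]≡n i≤n)))

-- Multiplying the generating function of the Gregory polynomials by log (1 + t) / t leaves (1 +
-- t)^x.
logCoeff⊛gregoryPoly : ∀ n x → (logCoeff ⊛ (λ m → gregoryPoly m x)) n ≡ binomℚ x n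
logCoeff⊛gregoryPoly n x = trans (⊛-assoc logCoeff gregoryCoeff (binomℚ x) n) (unit n)
  where
  unit : ∀ n → ((logCoeff ⊛ gregoryCoeff) ⊛ binomℚ x) n ≡ binomℚ x n
  unit zero    = refl
  unit (suc n) = begin
    ((logCoeff ⊛ gregoryCoeff) ⊛ binomℚ x) (suc n)
      ≡⟨ ⊛-suc (logCoeff ⊛ gregoryCoeff) (binomℚ x) n ⟩
    ((λ i → (logCoeff ⊛ gregoryCoeff) (suc i)) ⊛ binomℚ x) n ℚ.+ 1ℚ * binomℚ x (suc n)
      ≡⟨ cong (ℚ._+ 1ℚ * binomℚ x (suc n))
           (sumTo-0 n _ (λ m → trans (cong (_* binomℚ x m) (logCoeff⊛gregoryCoeff-suc (n ∸ m)))
             (ℚₚ.*-zeroˡ (binomℚ x m)))) ⟩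
    0ℚ ℚ.+ 1ℚ * binomℚ x (suc n)
      ≡⟨ solve 1 (λ b → con 0ℚ :+ con 1ℚ :* b := b) refl (binomℚ x (suc n)) ⟩
    binomℚ x (suc n) ∎

-- Binomial coefficients with rational upper argument

binomℚ-pascal : ∀ x n → binomℚ (x ℚ.+ 1ℚ) (suc n) ≡ binomℚ x (suc n) ℚ.+ binomℚ x n
binomℚ-pascal x zero    = solve 1 (λ x → con 1ℚ :* (((x :+ con 1ℚ) :- con 0ℚ) :* con 1ℚ)
  := con 1ℚ :* ((x :- con 0ℚ) :* con 1ℚ) :+ con 1ℚ) refl x
binomℚ-pascal x (suc n) = begin
  binomℚ (x ℚ.+ 1ℚ) (suc n) * ((x ℚ.+ 1ℚ - ℕ→ℚ (suc n)) * r)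
    ≡⟨ cong₂ (λ b s → b * ((x ℚ.+ 1ℚ - s) * r)) (binomℚ-pascal x n) (ℕ→ℚ-suc n) ⟩
  (b * ((x - m) * t) ℚ.+ b) * ((x ℚ.+ 1ℚ - (1ℚ ℚ.+ m)) * r)
    ≡⟨ solve 5 (λ b x m t r →
          (b :* ((x :- m) :* t) :+ b) :* ((x :+ con 1ℚ :- (con 1ℚ :+ m)) :* r)
       := (b :* ((x :- m) :* t)) :* ((x :- (con 1ℚ :+ m)) :* r)
          :+ (b :* ((x :- m) :* t) :+ b :* (x :- m)) :* r) refl b x m t r ⟩
  (b * ((x - m) * t)) * ((x - (1ℚ ℚ.+ m)) * r) ℚ.+ (b * ((x - m) * t) ℚ.+ b * (x - m)) * r
    ≡⟨ cong (λ u → (b * ((x - m) * t)) * ((x - (1ℚ ℚ.+ m)) * r) ℚ.+ (b * ((x - m) * t) ℚ.+ u) * r) absorb ⟩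
  (b * ((x - m) * t)) * ((x - (1ℚ ℚ.+ m)) * r) ℚ.+ (b * ((x - m) * t) ℚ.+ (b * ((x - m) * t)) * (1ℚ ℚ.+ m)) * r
    ≡⟨ solve 4 (λ c v m r → c :* (v :* r) :+ (c :+ c :* (con 1ℚ :+ m)) :* r
         := c :* (v :* r) :+ c :* ((con 1ℚ :+ (con 1ℚ :+ m)) :* r)) refl (b * ((x - m) * t)) (x - (1ℚ ℚ.+ m)) m r ⟩
  (b * ((x - m) * t)) * ((x - (1ℚ ℚ.+ m)) * r) ℚ.+ (b * ((x - m) * t)) * ((1ℚ ℚ.+ (1ℚ ℚ.+ m)) * r)
    ≡⟨ cong₂ (λ s u → (b * ((x - m) * t)) * ((x - s) * r) ℚ.+ (b * ((x - m) * t)) * u) (sym (ℕ→ℚ-suc n)) unit ⟩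
  binomℚ x (suc (suc n)) ℚ.+ binomℚ x (suc n) * 1ℚ
    ≡⟨ cong (binomℚ x (suc (suc n)) ℚ.+_) (ℚₚ.*-identityʳ (binomℚ x (suc n))) ⟩
  binomℚ x (suc (suc n)) ℚ.+ binomℚ x (suc n) ∎
  where
  b m t r : ℚ
  b = binomℚ x n
  m = ℕ→ℚ n
  t = recip n
  r = recip (suc n)
  unit : (1ℚ ℚ.+ (1ℚ ℚ.+ m)) * r ≡ 1ℚ
  unit = trans (cong (_* r) (sym (trans (ℕ→ℚ-suc (suc n)) (cong (1ℚ ℚ.+_) (ℕ→ℚ-suc n))))) (recip-inverse (suc n))
  -- Absorption, (x - n) binom (x, n) = (n + 1) binom (x, n + 1): the remainder becomes binom (x, n
  -- + 1) times (n + 2) r = 1.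
  absorb : b * (x - m) ≡ (b * ((x - m) * t)) * (1ℚ ℚ.+ m)
  absorb = begin
    b * (x - m)                           ≡⟨ ℚₚ.*-identityʳ (b * (x - m)) ⟨
    (b * (x - m)) * 1ℚ                    ≡⟨ cong ((b * (x - m)) *_) (trans (cong (_* t) (sym (ℕ→ℚ-suc n))) (recip-inverse n)) ⟨
    (b * (x - m)) * ((1ℚ ℚ.+ m) * t)      ≡⟨ solve 4 (λ b v s t → (b :* v) :* (s :* t) := (b :* (v :* t)) :* s) refl b (x - m) (1ℚ ℚ.+ m) t ⟩
    (b * ((x - m) * t)) * (1ℚ ℚ.+ m)      ∎

Δ^-binomℚ : ∀ k n x → Δ^ k (λ z → binomℚ z (k + n)) x ≡ binomℚ x n
Δ^-binomℚ zero    n x = refl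
Δ^-binomℚ (suc k) n x = begin
  Δ^ k (λ z → binomℚ z (suc k + n)) (x ℚ.+ 1ℚ) - Δ^ k (λ z → binomℚ z (suc k + n)) x
    ≡⟨ cong (λ j → Δ^ k (λ z → binomℚ z j) (x ℚ.+ 1ℚ) - Δ^ k (λ z → binomℚ z j) x) (ℕₚ.+-suc k n) ⟨
  Δ^ k (λ z → binomℚ z (k + suc n)) (x ℚ.+ 1ℚ) - Δ^ k (λ z → binomℚ z (k + suc n)) x
    ≡⟨ cong₂ _-_ (Δ^-binomℚ k (suc n) (x ℚ.+ 1ℚ)) (Δ^-binomℚ k (suc n) x) ⟩
  binomℚ (x ℚ.+ 1ℚ) (suc n) - binomℚ x (suc n)
    ≡⟨ cong (_- binomℚ x (suc n)) (binomℚ-pascal x n) ⟩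
  (binomℚ x (suc n) ℚ.+ binomℚ x n) - binomℚ x (suc n)
    ≡⟨ solve 2 (λ a b → (a :+ b) :- a := b) refl (binomℚ x (suc n)) (binomℚ x n) ⟩
  binomℚ x n ∎

Δ^-shift : ∀ k f x → Δ^ k (λ z → f (z ℚ.+ 1ℚ)) x ≡ Δ^ k f (x ℚ.+ 1ℚ)
Δ^-shift zero    f x = refl
Δ^-shift (suc k) f x = cong₂ _-_ (Δ^-shift k f (x ℚ.+ 1ℚ)) (Δ^-shift k f x)

-- These are the coefficients of (1 + t)^(-1). At m = p - 1 they give the only nonzero value of
-- binom (x, p - 1) modulo p.
binomℚ-−1 : ∀ m → binomℚ (- 1ℚ) m ≡ sgn m
binomℚ-−1 zero    = refl
binomℚ-−1 (suc m) = begin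
  binomℚ (- 1ℚ) m * ((- 1ℚ - ℕ→ℚ m) * recip m)
    ≡⟨ cong (_* ((- 1ℚ - ℕ→ℚ m) * recip m)) (binomℚ-−1 m) ⟩
  sgn m * ((- 1ℚ - ℕ→ℚ m) * recip m)
    ≡⟨ solve 3 (λ s m r → s :* (((:- con 1ℚ) :- m) :* r) := (:- s) :* ((con 1ℚ :+ m) :* r)) refl (sgn m) (ℕ→ℚ m) (recip m) ⟩
  (- sgn m) * ((1ℚ ℚ.+ ℕ→ℚ m) * recip m)
    ≡⟨ cong ((- sgn m) *_) (trans (cong (_* recip m) (sym (ℕ→ℚ-suc m))) (recip-inverse m)) ⟩
  (- sgn m) * 1ℚ
    ≡⟨ ℚₚ.*-identityʳ (- sgn m) ⟩
  - sgn m ∎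

binomℚ-vanishes : ∀ {s m} → s < m → binomℚ (ℕ→ℚ s) m ≡ 0ℚ
binomℚ-vanishes {s} {suc m} (s≤s s≤m) = [ below , diagonal ]′ (ℕₚ.m≤n⇒m<n∨m≡n s≤m)
  where
  below : s < m → binomℚ (ℕ→ℚ s) (suc m) ≡ 0ℚ
  below s<m = trans (cong (_* ((ℕ→ℚ s - ℕ→ℚ m) * recip m)) (binomℚ-vanishes s<m)) (ℚₚ.*-zeroˡ ((ℕ→ℚ s - ℕ→ℚ m) * recip m))
  diagonal : s ≡ m → binomℚ (ℕ→ℚ s) (suc m) ≡ 0ℚ
  diagonal refl = solve 3 (λ b s r → b :* ((s :- s) :* r) := con 0ℚ) refl (binomℚ (ℕ→ℚ s) s) (ℕ→ℚ s) (recip s)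

sgn≡-1^ : ∀ n → sgn n ≡ (- 1ℚ) ^ℚ n
sgn≡-1^ zero    = refl
sgn≡-1^ (suc n) = trans (cong -_ (sgn≡-1^ n)) (solve 1 (λ a → :- a := (:- con 1ℚ) :* a) refl ((- 1ℚ) ^ℚ n))

-- Differences of ℓ and the convolution with the logarithm

Δ^-ℓ : ∀ {p m} → p ≡ suc m → ∀ k y → 1 < k → Δ^ k (λ z → ℓ𝒜 z p) y ≡ recip m * Δ^ k (_^ℚ p) y
Δ^-ℓ {p} {m} refl k y 1<k = begin
  Δ^ k (λ z → ((z ^ℚ p) - z) * recip m) y
    ≡⟨ Δ^-cong k (λ z → solve 3 (λ a z r → (a :- z) :* r := r :* a :+ (:- r) :* (z :* con 1ℚ)) refl
         (z ^ℚ p) z (recip m)) y ⟩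
  Δ^ k (λ z → recip m * (z ^ℚ p) ℚ.+ (- recip m) * (z ^ℚ 1)) y
    ≡⟨ Δ^-linear k (recip m) (- recip m) (_^ℚ p) (_^ℚ 1) y ⟩
  recip m * Δ^ k (_^ℚ p) y ℚ.+ (- recip m) * Δ^ k (_^ℚ 1) y
    -- The linear term -z/p is not p-integral in general; it disappears because the order is at
    -- least 2.
    ≡⟨ cong (λ t → recip m * Δ^ k (_^ℚ p) y ℚ.+ (- recip m) * t) (Δ^-pow≡0 1<k y) ⟩
  recip m * Δ^ k (_^ℚ p) y ℚ.+ (- recip m) * 0ℚ
    ≡⟨ solve 2 (λ a r → a :+ (:- r) :* con 0ℚ := a) refl (recip m * Δ^ k (_^ℚ p) y) (recip m) ⟩
  recip m * Δ^ k (_^ℚ p) y ∎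

-- Differentiating y^p / p gives y^(p-1) with no denominator left. The condition 0 < k makes all
-- orders k + 1 + i at least 2, and n + k = p - 1 puts the discarded terms above degree p.
logΔ-ℓ : ∀ {p m} → p ≡ suc m → ∀ n k → 0 < k → n + k ≡ m → ∀ y →
  logΔ n k (λ z → ℓ𝒜 z p) y ≡ Δ^ k (_^ℚ m) y
logΔ-ℓ {p} {m} refl n k 0<k n+k≡m y = begin
  sumTo n (λ i → logCoeff i * Δ^ (suc k + i) (λ z → ℓ𝒜 z p) y)
    ≡⟨ sumTo-cong n (λ i _ → trans
         (cong (logCoeff i *_) (Δ^-ℓ {p} refl (suc k + i) y (s≤s (ℕₚ.≤-trans 0<k (ℕₚ.m≤m+n k i)))))
         (solve 3 (λ a r d → a :* (r :* d) := r :* (a :* d)) refl (logCoeff i) (recip m) (Δ^ (suc k + i) (_^ℚ p) y))) ⟩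
  sumTo n (λ i → recip m * (logCoeff i * Δ^ (suc k + i) (_^ℚ p) y))
    ≡⟨ sumTo-*ˡ n (recip m) _ ⟩
  recip m * logΔ n k (_^ℚ p) y
    ≡⟨ cong (recip m *_) (logΔ-pow k n m (ℕₚ.≤-reflexive (sym n+k≡m)) y) ⟩
  recip m * (ℕ→ℚ p * Δ^ k (_^ℚ m) y)
    ≡⟨ solve 3 (λ r p d → r :* (p :* d) := (p :* r) :* d) refl (recip m) (ℕ→ℚ p) (Δ^ k (_^ℚ m) y) ⟩
  (ℕ→ℚ p * recip m) * Δ^ k (_^ℚ m) y
    ≡⟨ cong (_* Δ^ k (_^ℚ m) y) (recip-inverse m) ⟩
  1ℚ * Δ^ k (_^ℚ m) y
    ≡⟨ ℚₚ.*-identityˡ (Δ^ k (_^ℚ m) y) ⟩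
  Δ^ k (_^ℚ m) y ∎

-- The sequence H_n of the overview; at n = p - k the order of the difference is k.
ℓΔ : ℕ → ℚ → ℕ → ℚ
ℓΔ p x n = - Δ^ (p ∸ n) (λ z → ℓ𝒜 z p) (x ℚ.+ 1ℚ)

-- Since p = n + k + 1, reversing the convolution pairs a_i with the difference of order p - (n - i)
-- = k + 1 + i, and the sum is minus `logΔ n k`.
logCoeff⊛ℓΔ : ∀ {p m} → p ≡ suc m → ∀ n k → 0 < k → n + k ≡ m → ∀ x →
  (logCoeff ⊛ ℓΔ p x) n ≡ - Δ^ k (_^ℚ m) (x ℚ.+ 1ℚ)
logCoeff⊛ℓΔ {p} {m} p≡ n k 0<k n+k≡m x = begin
  (logCoeff ⊛ ℓΔ p x) n
    ≡⟨ sumTo-reverse n _ ⟩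
  sumTo n (λ i → logCoeff (n ∸ (n ∸ i)) * ℓΔ p x (n ∸ i))
    ≡⟨ sumTo-cong n term ⟩
  sumTo n (λ i → (- 1ℚ) * (logCoeff i * Δ^ (suc k + i) (λ z → ℓ𝒜 z p) (x ℚ.+ 1ℚ)))
    ≡⟨ sumTo-*ˡ n (- 1ℚ) _ ⟩
  (- 1ℚ) * logΔ n k (λ z → ℓ𝒜 z p) (x ℚ.+ 1ℚ)
    ≡⟨ cong ((- 1ℚ) *_) (logΔ-ℓ p≡ n k 0<k n+k≡m (x ℚ.+ 1ℚ)) ⟩
  (- 1ℚ) * Δ^ k (_^ℚ m) (x ℚ.+ 1ℚ)
    ≡⟨ solve 1 (λ a → (:- con 1ℚ) :* a := :- a) refl (Δ^ k (_^ℚ m) (x ℚ.+ 1ℚ)) ⟩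
  - Δ^ k (_^ℚ m) (x ℚ.+ 1ℚ) ∎
  where
  order : ∀ i → i ≤ n → p ∸ (n ∸ i) ≡ suc k + i
  order i i≤n = begin
    p ∸ (n ∸ i)                       ≡⟨ cong (_∸ (n ∸ i)) split ⟩
    (suc k + i) + (n ∸ i) ∸ (n ∸ i)   ≡⟨ ℕₚ.m+n∸n≡m (suc k + i) (n ∸ i) ⟩
    suc k + i                         ∎
    where
    split : p ≡ (suc k + i) + (n ∸ i)
    split = begin
      p                         ≡⟨ p≡ ⟩
      suc m                     ≡⟨ cong suc n+k≡m ⟨
      suc (n + k)               ≡⟨ cong suc (ℕₚ.+-comm n k) ⟩
      suc k + n                 ≡⟨ cong (suc k +_) (ℕₚ.m+[n∸m]≡n i≤n) ⟨
      suc k + (i + (n ∸ i))     ≡⟨ ℕₚ.+-assoc (suc k) i (n ∸ i) ⟨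
      (suc k + i) + (n ∸ i)     ∎
  term : ∀ i → i ≤ n → logCoeff (n ∸ (n ∸ i)) * ℓΔ p x (n ∸ i)
    ≡ (- 1ℚ) * (logCoeff i * Δ^ (suc k + i) (λ z → ℓ𝒜 z p) (x ℚ.+ 1ℚ))
  term i i≤n = trans
    (cong₂ (λ a b → logCoeff a * (- Δ^ b (λ z → ℓ𝒜 z p) (x ℚ.+ 1ℚ))) (ℕₚ.m∸[m∸n]≡n i≤n) (order i i≤n))
    (solve 2 (λ a d → a :* (:- d) := (:- con 1ℚ) :* (a :* d)) refl (logCoeff i) (Δ^ (suc k + i) (λ z → ℓ𝒜 z p) (x ℚ.+ 1ℚ)))

-- Congruences modulo a prime in the ring of p-integral rationals

prime∤! : ∀ {p} → Prime p → ∀ {m} → m < p → ¬ p ∣ m ℕ.!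
prime∤! pr {zero}  _   p∣1 = contradiction (subst Prime (Div.∣1⇒≡1 p∣1) pr) ¬prime[1]
prime∤! pr {suc m} m<p p∣  = [ Div.>⇒∤ m<p , prime∤! pr (ℕₚ.<⇒≤ m<p) ]′ (euclidsLemma (suc m) (m ℕ.!) pr p∣)

p∣p! : ∀ {p} → Prime p → p ∣ p ℕ.!
p∣p! {zero}  pr = contradiction pr ¬prime[0]
p∣p! {suc p} pr = Div.m∣m*n (p ℕ.!)

prime∣C : ∀ {p} → Prime p → ∀ {m} → 0 < m → m < p → p ∣ p C m
prime∣C {p} pr {m} 0<m m<p = [ id , (λ p∣d → contradiction p∣d p∤d) ]′
  (euclidsLemma (p C m) d pr (subst (p ∣_) (sym eq) (p∣p! pr)))
  where
  d : ℕ
  d = m ℕ.! ℕ.* (p ∸ m) ℕ.!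
  p∤d : ¬ p ∣ d
  p∤d p∣d = [ prime∤! pr m<p , prime∤! pr (ℕₚ.∸-monoʳ-< 0<m (ℕₚ.<⇒≤ m<p)) ]′ (euclidsLemma (m ℕ.!) _ pr p∣d)
  eq : (p C m) ℕ.* d ≡ p ℕ.!
  eq = trans (cong (ℕ._* d) (nCk≡n!/k![n-k]! (ℕₚ.<⇒≤ m<p)))
    (m/n*n≡m {{m ℕₚ.!* (p ∸ m) !≢0}} (k![n∸k]!∣n! (ℕₚ.<⇒≤ m<p)))

-- Here `q` is p - 2, both the last index of the recursion and the exponent that inverts units. The
-- equation keeps `p` a variable while p - 1 is available as the literal successor `suc q`.
module Modular {p q : ℕ} (p≡2+q : p ≡ suc (suc q)) (pr : Prime p) where

  p∤1 : ¬ p ∣ 1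
  p∤1 p∣1 = contradiction (subst Prime (Div.∣1⇒≡1 p∣1) pr) ¬prime[1]

  p∤< : ∀ {m} → suc m < p → ¬ p ∣ suc m
  p∤< = Div.>⇒∤

  p∤* : ∀ {m n} → ¬ p ∣ m → ¬ p ∣ n → ¬ p ∣ m ℕ.* n
  p∤* {m} {n} p∤m p∤n p∣mn = [ p∤m , p∤n ]′ (euclidsLemma m n pr p∣mn)

  -- The fraction may be unreduced: any denominator prime to p will do, so closure under ring
  -- operations involves no gcd.
  record Integral (x : ℚ) : Set where
    constructor integral
    field
      denominator : ℕ
      numerator   : ℤ
      p∤d         : ¬ p ∣ denominator
      cleared     : x * ℕ→ℚ denominator ≡ ℤ→ℚ numerator

  ℤ-integral : ∀ n → Integral (ℤ→ℚ n)
  ℤ-integral n = integral 1 n p∤1 (ℚₚ.*-identityʳ (ℤ→ℚ n))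

  ℕ-integral : ∀ n → Integral (ℕ→ℚ n)
  ℕ-integral n = ℤ-integral (ℤ.+ n)

  +-integral : ∀ {x y} → Integral x → Integral y → Integral (x ℚ.+ y)
  +-integral {x} {y} (integral d m d∤ xd) (integral e n e∤ ye) =
    integral (d ℕ.* e) (m ℤ.* ℤ.+ e ℤ.+ n ℤ.* ℤ.+ d) (p∤* d∤ e∤) (begin
      (x ℚ.+ y) * ℕ→ℚ (d ℕ.* e)
        ≡⟨ cong ((x ℚ.+ y) *_) (ℕ→ℚ-* d e) ⟩
      (x ℚ.+ y) * (ℕ→ℚ d * ℕ→ℚ e)
        ≡⟨ solve 4 (λ x y d e → (x :+ y) :* (d :* e) := (x :* d) :* e :+ (y :* e) :* d) refl x y (ℕ→ℚ d) (ℕ→ℚ e) ⟩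
      (x * ℕ→ℚ d) * ℕ→ℚ e ℚ.+ (y * ℕ→ℚ e) * ℕ→ℚ d
        ≡⟨ cong₂ (λ a b → a * ℕ→ℚ e ℚ.+ b * ℕ→ℚ d) xd ye ⟩
      ℤ→ℚ m * ℕ→ℚ e ℚ.+ ℤ→ℚ n * ℕ→ℚ d
        ≡⟨ cong₂ ℚ._+_ (ℤ→ℚ-* m (ℤ.+ e)) (ℤ→ℚ-* n (ℤ.+ d)) ⟨
      ℤ→ℚ (m ℤ.* ℤ.+ e) ℚ.+ ℤ→ℚ (n ℤ.* ℤ.+ d)
        ≡⟨ ℤ→ℚ-+ (m ℤ.* ℤ.+ e) (n ℤ.* ℤ.+ d) ⟨
      ℤ→ℚ (m ℤ.* ℤ.+ e ℤ.+ n ℤ.* ℤ.+ d) ∎)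

  *-integral : ∀ {x y} → Integral x → Integral y → Integral (x * y)
  *-integral {x} {y} (integral d m d∤ xd) (integral e n e∤ ye) =
    integral (d ℕ.* e) (m ℤ.* n) (p∤* d∤ e∤) (begin
      (x * y) * ℕ→ℚ (d ℕ.* e)
        ≡⟨ cong ((x * y) *_) (ℕ→ℚ-* d e) ⟩
      (x * y) * (ℕ→ℚ d * ℕ→ℚ e)
        ≡⟨ solve 4 (λ x y d e → (x :* y) :* (d :* e) := (x :* d) :* (y :* e)) refl x y (ℕ→ℚ d) (ℕ→ℚ e) ⟩
      (x * ℕ→ℚ d) * (y * ℕ→ℚ e)
        ≡⟨ cong₂ _*_ xd ye ⟩
      ℤ→ℚ m * ℤ→ℚ n
        ≡⟨ ℤ→ℚ-* m n ⟨
      ℤ→ℚ (m ℤ.* n) ∎)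

  neg-integral : ∀ {x} → Integral x → Integral (- x)
  neg-integral {x} (integral d m d∤ xd) = integral d (ℤ.- m) d∤
    (trans (solve 2 (λ x d → (:- x) :* d := :- (x :* d)) refl x (ℕ→ℚ d)) (trans (cong -_ xd) (sym (ℤ→ℚ-neg m))))

  recip-integral : ∀ {m} → ¬ p ∣ suc m → Integral (recip m)
  recip-integral {m} p∤ = integral (suc m) (ℤ.+ 1) p∤ (trans (ℚₚ.*-comm (recip m) (ℕ→ℚ (suc m))) (recip-inverse m))

  sgn-integral : ∀ n → Integral (sgn n)
  sgn-integral zero    = ℕ-integral 1
  sgn-integral (suc n) = neg-integral (sgn-integral n)

  ^-integral : ∀ {x} → Integral x → ∀ n → Integral (x ^ℚ n)
  ^-integral ix zero    = ℕ-integral 1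
  ^-integral ix (suc n) = *-integral ix (^-integral ix n)

  infix 4 _≈_
  -- Membership of the difference in p times the p-integral rationals. This makes sense for values
  -- such as those of ℓ before their integrality is known; the price is paid in `*-cong`, which asks
  -- for integral factors.
  record _≈_ (x y : ℚ) : Set where
    constructor congruent
    field
      quotient   : ℚ
      isIntegral : Integral quotient
      difference : x - y ≡ ℕ→ℚ p * quotient

  ≈-reflexive : ∀ {x y} → x ≡ y → x ≈ y
  ≈-reflexive {x} refl = congruent 0ℚ (ℕ-integral 0)
    (solve 2 (λ x p → x :- x := p :* con 0ℚ) refl x (ℕ→ℚ p))

  ≈-refl : ∀ {x} → x ≈ x
  ≈-refl = ≈-reflexive refl

  *-congˡ : ∀ {c x y} → Integral c → x ≈ y → c * x ≈ c * y
  *-congˡ {c} {x} {y} ic (congruent r ir eq) = congruent (c * r) (*-integral ic ir)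
    (trans (solve 3 (λ c x y → c :* x :- c :* y := c :* (x :- y)) refl c x y)
    (trans (cong (c *_) eq) (solve 3 (λ c p r → c :* (p :* r) := p :* (c :* r)) refl c (ℕ→ℚ p) r)))

  +-cong : ∀ {x x′ y y′} → x ≈ x′ → y ≈ y′ → x ℚ.+ y ≈ x′ ℚ.+ y′
  +-cong {x} {x′} {y} {y′} (congruent r ir eq) (congruent s is eq′) = congruent (r ℚ.+ s) (+-integral ir is)
    (trans (solve 4 (λ x x′ y y′ → (x :+ y) :- (x′ :+ y′) := (x :- x′) :+ (y :- y′)) refl x x′ y y′)
    (trans (cong₂ ℚ._+_ eq eq′) (sym (ℚₚ.*-distribˡ-+ (ℕ→ℚ p) r s))))

  neg-cong : ∀ {x y} → x ≈ y → - x ≈ - y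
  neg-cong {x} {y} (congruent r ir eq) = congruent (- r) (neg-integral ir)
    (trans (solve 2 (λ x y → (:- x) :- (:- y) := :- (x :- y)) refl x y)
    (trans (cong -_ eq) (solve 2 (λ p r → :- (p :* r) := p :* (:- r)) refl (ℕ→ℚ p) r)))

  ≈-sym : ∀ {x y} → x ≈ y → y ≈ x
  ≈-sym {x} {y} (congruent r ir eq) = congruent (- r) (neg-integral ir)
    (trans (solve 2 (λ x y → y :- x := :- (x :- y)) refl x y)
    (trans (cong -_ eq) (solve 2 (λ p r → :- (p :* r) := p :* (:- r)) refl (ℕ→ℚ p) r)))

  ≈-trans : ∀ {x y z} → x ≈ y → y ≈ z → x ≈ z
  ≈-trans {x} {y} {z} (congruent r ir eq) (congruent s is eq′) = congruent (r ℚ.+ s) (+-integral ir is)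
    (trans (solve 3 (λ x y z → x :- z := (x :- y) :+ (y :- z)) refl x y z)
    (trans (cong₂ ℚ._+_ eq eq′) (sym (ℚₚ.*-distribˡ-+ (ℕ→ℚ p) r s))))

  *-cong : ∀ {x x′ y y′} → Integral x′ → Integral y → x ≈ x′ → y ≈ y′ → x * y ≈ x′ * y′
  *-cong {x} {x′} {y} {y′} ix′ iy x≈ y≈ = ≈-trans
    (≈-trans (≈-reflexive (ℚₚ.*-comm x y)) (≈-trans (*-congˡ iy x≈) (≈-reflexive (ℚₚ.*-comm y x′))))
    (*-congˡ ix′ y≈)

  ^-cong : ∀ {x y} → Integral x → Integral y → x ≈ y → ∀ n → x ^ℚ n ≈ y ^ℚ n
  ^-cong ix iy x≈y zero    = ≈-refl
  ^-cong ix iy x≈y (suc n) = *-cong iy (^-integral ix n) x≈y (^-cong ix iy x≈y n)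

  binomℚ-integral : ∀ {x} → Integral x → ∀ {m} → m < p → Integral (binomℚ x m)
  binomℚ-integral ix {zero}  _   = ℕ-integral 1
  binomℚ-integral ix {suc m} m<p = *-integral (binomℚ-integral ix (ℕₚ.<⇒≤ m<p))
    (*-integral (+-integral ix (neg-integral (ℕ-integral m))) (recip-integral (p∤< m<p)))

  binomℚ-cong : ∀ {x y} → Integral x → Integral y → x ≈ y → ∀ {m} → m < p → binomℚ x m ≈ binomℚ y m
  binomℚ-cong ix iy x≈y {zero}  _   = ≈-refl
  binomℚ-cong ix iy x≈y {suc m} m<p = *-cong (binomℚ-integral iy m<p′)
    (*-integral (+-integral ix (neg-integral (ℕ-integral m))) ir)
    (binomℚ-cong ix iy x≈y m<p′)
    (*-cong (+-integral iy (neg-integral (ℕ-integral m))) ir (+-cong x≈y ≈-refl) ≈-refl)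
    where
    m<p′ : m < p
    m<p′ = ℕₚ.<⇒≤ m<p
    ir : Integral (recip m)
    ir = recip-integral (p∤< m<p)

  ∣⇒≈0 : ∀ {n} → p ∣ n → ℕ→ℚ n ≈ 0ℚ
  ∣⇒≈0 (Div.divides c refl) = congruent (ℕ→ℚ c) (ℕ-integral c)
    (trans (ℚₚ.+-identityʳ (ℕ→ℚ (c ℕ.* p))) (trans (ℕ→ℚ-* c p) (ℚₚ.*-comm (ℕ→ℚ c) (ℕ→ℚ p))))

  -- Cross-multiplying p n / d with the lowest terms of x - y shows that p divides the reduced
  -- numerator times d, and p does not divide d.
  ≈⇒≡0mod : ∀ {x y} → x ≈ y → ≡0mod p (x - y)
  ≈⇒≡0mod {x} {y} (congruent r (integral d n p∤d rd) eq) =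
    [ id , (λ p∣d → contradiction p∣d p∤d) ]′ (euclidsLemma _ d pr p∣)
    where
    z : ℚ
    z = x - y
    cross : ℚ.↥ z ℤ.* ℤ.+ d ≡ ℤ.+ p ℤ.* (n ℤ.* ℚ.↧ z)
    cross = ℤ→ℚ-injective (begin
      ℤ→ℚ (ℚ.↥ z ℤ.* ℤ.+ d)                       ≡⟨ ℤ→ℚ-* (ℚ.↥ z) (ℤ.+ d) ⟩
      ℤ→ℚ (ℚ.↥ z) * ℕ→ℚ d                         ≡⟨ cong (_* ℕ→ℚ d) (↧-clear z) ⟨
      (z * ℤ→ℚ (ℚ.↧ z)) * ℕ→ℚ d                   ≡⟨ cong (λ t → (t * ℤ→ℚ (ℚ.↧ z)) * ℕ→ℚ d) eq ⟩
      ((ℕ→ℚ p * r) * ℤ→ℚ (ℚ.↧ z)) * ℕ→ℚ d         ≡⟨ solve 4 (λ p r e d → ((p :* r) :* e) :* d := p :* ((r :* d) :* e)) refl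
                                                        (ℕ→ℚ p) r (ℤ→ℚ (ℚ.↧ z)) (ℕ→ℚ d) ⟩
      ℕ→ℚ p * ((r * ℕ→ℚ d) * ℤ→ℚ (ℚ.↧ z))         ≡⟨ cong (λ t → ℕ→ℚ p * (t * ℤ→ℚ (ℚ.↧ z))) rd ⟩
      ℕ→ℚ p * (ℤ→ℚ n * ℤ→ℚ (ℚ.↧ z))               ≡⟨ cong (ℕ→ℚ p *_) (ℤ→ℚ-* n (ℚ.↧ z)) ⟨
      ℕ→ℚ p * ℤ→ℚ (n ℤ.* ℚ.↧ z)                   ≡⟨ ℤ→ℚ-* (ℤ.+ p) (n ℤ.* ℚ.↧ z) ⟨
      ℤ→ℚ (ℤ.+ p ℤ.* (n ℤ.* ℚ.↧ z))               ∎)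
    p∣ : p ∣ ℤ.∣ ℚ.↥ z ∣ ℕ.* d
    p∣ = subst (p ∣_) (trans (sym (ℤₚ.abs-* (ℤ.+ p) (n ℤ.* ℚ.↧ z)))
        (trans (cong ℤ.∣_∣ (sym cross)) (ℤₚ.abs-* (ℚ.↥ z) (ℤ.+ d))))
      (Div.m∣m*n ℤ.∣ n ℤ.* ℚ.↧ z ∣)

  sumTo-≈ : ∀ n {f g} → (∀ i → i ≤ n → f i ≈ g i) → sumTo n f ≈ sumTo n g
  sumTo-≈ zero    h = h 0 z≤n
  sumTo-≈ (suc n) h = +-cong (sumTo-≈ n (λ i i≤n → h i (ℕₚ.m≤n⇒m≤1+n i≤n))) (h (suc n) ℕₚ.≤-refl)

  -- A series with constant term 1 is inverted degree by degree: subtracting from the convolution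
  -- all terms with lower entries of `f` leaves its top entry. Integrality is asked only up to `n`,
  -- because `logCoeff` fails it at index p - 1.
  ⊛-cancelˡ : ∀ (a f g : ℕ → ℚ) → a 0 ≡ 1ℚ → ∀ n → (∀ i → i ≤ n → Integral (a i)) →
    (∀ i → i ≤ n → (a ⊛ f) i ≈ (a ⊛ g) i) → ∀ i → i ≤ n → f i ≈ g i
  ⊛-cancelˡ a f g a₀ zero    ia h zero z≤n = subst₂ _≈_ (unit f) (unit g) (h 0 z≤n)
    where
    unit : ∀ f → a 0 * f 0 ≡ f 0
    unit f = trans (cong (_* f 0) a₀) (ℚₚ.*-identityˡ (f 0))
  ⊛-cancelˡ a f g a₀ (suc n) ia h i i≤ = [ (λ { (s≤s i≤n) → lower i i≤n }) , (λ { refl → top }) ]′ (ℕₚ.m≤n⇒m<n∨m≡n i≤)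
    where
    lower : ∀ i → i ≤ n → f i ≈ g i
    lower = ⊛-cancelˡ a f g a₀ n (λ i i≤n → ia i (ℕₚ.m≤n⇒m≤1+n i≤n)) (λ i i≤n → h i (ℕₚ.m≤n⇒m≤1+n i≤n))
    a′ : ℕ → ℚ
    a′ i = a (suc i)
    last : ∀ f → (a ⊛ f) (suc n) - (a′ ⊛ f) n ≡ f (suc n)
    last f = begin
      (a ⊛ f) (suc n) - (a′ ⊛ f) n
        ≡⟨ cong (_- (a′ ⊛ f) n) (⊛-suc a f n) ⟩
      ((a′ ⊛ f) n ℚ.+ a 0 * f (suc n)) - (a′ ⊛ f) n
        ≡⟨ cong (λ t → ((a′ ⊛ f) n ℚ.+ t * f (suc n)) - (a′ ⊛ f) n) a₀ ⟩
      ((a′ ⊛ f) n ℚ.+ 1ℚ * f (suc n)) - (a′ ⊛ f) n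
        ≡⟨ solve 2 (λ s t → (s :+ con 1ℚ :* t) :- s := t) refl ((a′ ⊛ f) n) (f (suc n)) ⟩
      f (suc n) ∎
    top : f (suc n) ≈ g (suc n)
    top = subst₂ _≈_ (last f) (last g) (+-cong (h (suc n) ℕₚ.≤-refl)
      (neg-cong (sumTo-≈ n (λ i i≤n → *-congˡ (ia (suc (n ∸ i)) (s≤s (ℕₚ.m∸n≤m n i))) (lower i i≤n)))))

  -- Fermat's little theorem

  sumTo-≈-ends : ∀ n f → (∀ i → 0 < i → i < suc n → f i ≈ 0ℚ) → sumTo (suc n) f ≈ f 0 ℚ.+ f (suc n)
  sumTo-≈-ends n f h = +-cong (head n (λ i 0<i i≤n → h i 0<i (s≤s i≤n))) ≈-refl
    where
    head : ∀ n → (∀ i → 0 < i → i ≤ n → f i ≈ 0ℚ) → sumTo n f ≈ f 0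
    head zero    h = ≈-refl
    head (suc n) h = ≈-trans
      (+-cong (head n (λ i 0<i i≤n → h i 0<i (ℕₚ.m≤n⇒m≤1+n i≤n))) (h (suc n) (s≤s z≤n) ℕₚ.≤-refl))
      (≈-reflexive (ℚₚ.+-identityʳ (f 0)))

  binomialSum-≈ : ∀ f → (∀ i → Integral (f i)) → binomialSum p f ≈ f 0 ℚ.+ f p
  binomialSum-≈ f if = ≈-trans
    (subst (λ n → sumTo n F ≈ F 0 ℚ.+ F n) (sym p≡2+q)
      (sumTo-≈-ends (suc q) F (λ i 0<i i<p → ≈-trans
        (*-cong (ℕ-integral 0) (if i) (∣⇒≈0 (prime∣C pr 0<i (subst (i <_) (sym p≡2+q) i<p))) ≈-refl)
        (≈-reflexive (ℚₚ.*-zeroˡ (f i))))))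
    (≈-reflexive (cong₂ ℚ._+_ (ℚₚ.*-identityˡ (f 0))
      (trans (cong (λ t → ℕ→ℚ t * f p) (nCn≡1 p)) (ℚₚ.*-identityˡ (f p)))))
    where
    F : ℕ → ℚ
    F j = ℕ→ℚ (p C j) * f j

  fermat : ∀ n → ℕ→ℚ n ^ℚ p ≈ ℕ→ℚ n
  fermat zero    = ≈-reflexive (trans (cong (0ℚ ^ℚ_) p≡2+q) (ℚₚ.*-zeroˡ (0ℚ ^ℚ suc q)))
  fermat (suc n) = subst₂ _≈_
    (trans (sym (binomial-theorem (ℕ→ℚ n) p)) (cong (_^ℚ p) (sym (ℕ→ℚ-suc n))))
    (sym (ℕ→ℚ-suc n))
    (≈-trans (binomialSum-≈ (ℕ→ℚ n ^ℚ_) (^-integral (ℕ-integral n))) (+-cong (≈-refl {1ℚ}) (fermat n)))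

  fermat-unit : ∀ {n} → ¬ p ∣ suc n → ℕ→ℚ (suc n) ^ℚ suc q ≈ 1ℚ
  fermat-unit {n} p∤n = subst₂ _≈_
    (begin
      recip n * (x ^ℚ p)             ≡⟨ cong (λ m → recip n * (x ^ℚ m)) p≡2+q ⟩
      recip n * (x * (x ^ℚ suc q))   ≡⟨ solve 3 (λ r x y → r :* (x :* y) := (x :* r) :* y) refl (recip n) x (x ^ℚ suc q) ⟩
      (x * recip n) * (x ^ℚ suc q)   ≡⟨ cong (_* (x ^ℚ suc q)) (recip-inverse n) ⟩
      1ℚ * (x ^ℚ suc q)              ≡⟨ ℚₚ.*-identityˡ (x ^ℚ suc q) ⟩
      x ^ℚ suc q                     ∎)
    (trans (ℚₚ.*-comm (recip n) x) (recip-inverse n))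
    (*-congˡ (recip-integral p∤n) (fermat (suc n)))
    where
    x : ℚ
    x = ℕ→ℚ (suc n)

  -- Residues of p-integral rationals and the values of binom (x, p - 1)

  ℤ-residue : ∀ z → ∃ λ r → r < p × ℤ→ℚ z ≈ ℕ→ℚ r
  ℤ-residue z = r , ℤ÷.n%ℕd<d z p {{prime⇒nonZero pr}} , congruent (ℤ→ℚ c) (ℤ-integral c) (begin
    ℤ→ℚ z - ℕ→ℚ r
      ≡⟨ cong (λ t → ℤ→ℚ t - ℕ→ℚ r) (ℤ÷.a≡a%ℕn+[a/ℕn]*n z p {{prime⇒nonZero pr}}) ⟩
    ℤ→ℚ (ℤ.+ r ℤ.+ c ℤ.* ℤ.+ p) - ℕ→ℚ r
      ≡⟨ cong (_- ℕ→ℚ r) (trans (ℤ→ℚ-+ (ℤ.+ r) (c ℤ.* ℤ.+ p)) (cong (ℕ→ℚ r ℚ.+_) (ℤ→ℚ-* c (ℤ.+ p)))) ⟩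
    (ℕ→ℚ r ℚ.+ ℤ→ℚ c * ℕ→ℚ p) - ℕ→ℚ r
      ≡⟨ solve 3 (λ r c p → (r :+ c :* p) :- r := p :* c) refl (ℕ→ℚ r) (ℤ→ℚ c) (ℕ→ℚ p) ⟩
    ℕ→ℚ p * ℤ→ℚ c ∎)
    where
    instance
      p≢0 : ℕ.NonZero p
      p≢0 = prime⇒nonZero pr
    r : ℕ
    r = z ℤ.%ℕ p
    c : ℤ
    c = z ℤ./ℕ p

  -- d ^ (p - 2) inverts the denominator d by Fermat's little theorem.
  residue : ∀ {x} → Integral x → ∃ λ r → r < p × x ≈ ℕ→ℚ r
  residue (integral zero n p∤0 _) = contradiction (p Div.∣0) p∤0
  residue {x} ix@(integral d@(suc _) n p∤d xd) = residue-≈ x≈z (ℤ-residue z)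
    where
    z : ℤ
    z = n ℤ.* ℤ.+ (d ℕ.^ q)
    residue-≈ : ∀ {y} → x ≈ y → (∃ λ r → r < p × y ≈ ℕ→ℚ r) → ∃ λ r → r < p × x ≈ ℕ→ℚ r
    residue-≈ x≈y (r , r<p , y≈r) = r , r<p , ≈-trans x≈y y≈r
    x≈z : x ≈ ℤ→ℚ z
    x≈z = ≈-sym (subst₂ _≈_
      (begin
        x * (ℕ→ℚ d ^ℚ suc q)             ≡⟨ ℚₚ.*-assoc x (ℕ→ℚ d) (ℕ→ℚ d ^ℚ q) ⟨
        (x * ℕ→ℚ d) * (ℕ→ℚ d ^ℚ q)       ≡⟨ cong₂ _*_ xd (sym (ℕ→ℚ-^ d q)) ⟩
        ℤ→ℚ n * ℕ→ℚ (d ℕ.^ q)            ≡⟨ ℤ→ℚ-* n (ℤ.+ (d ℕ.^ q)) ⟨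
        ℤ→ℚ z        ∎)
      (ℚₚ.*-identityʳ x)
      (*-congˡ ix (fermat-unit p∤d)))

  1+q<p : suc q < p
  1+q<p = subst (suc q <_) (sym p≡2+q) ℕₚ.≤-refl

  −1-integral : Integral (- 1ℚ)
  −1-integral = neg-integral (ℕ-integral 1)

  -- Replacing -1 by p - 1 turns the sign into a (p-1)-st power of a unit, so p = 2 is covered
  -- without a parity argument.
  sgn[p-1]≈1 : sgn (suc q) ≈ 1ℚ
  sgn[p-1]≈1 = ≈-trans (≈-reflexive (sgn≡-1^ (suc q)))
    (≈-trans (^-cong −1-integral (ℕ-integral (suc q)) −1≈ (suc q)) (fermat-unit (p∤< 1+q<p)))
    where
    −1≈ : - 1ℚ ≈ ℕ→ℚ (suc q)
    −1≈ = congruent (- 1ℚ) −1-integral (begin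
      - 1ℚ - ℕ→ℚ (suc q)               ≡⟨ solve 1 (λ a → (:- con 1ℚ) :- a := (con 1ℚ :+ a) :* (:- con 1ℚ)) refl (ℕ→ℚ (suc q)) ⟩
      (1ℚ ℚ.+ ℕ→ℚ (suc q)) * (- 1ℚ)    ≡⟨ cong (_* (- 1ℚ)) (trans (cong ℕ→ℚ p≡2+q) (ℕ→ℚ-suc (suc q))) ⟨
      ℕ→ℚ p * (- 1ℚ)                   ∎)

  -- Both sides are the indicator function of x ≡ -1 modulo p.
  binomℚ[p-1] : ∀ {x} → Integral x → binomℚ x (suc q) ≈ 1ℚ - ((x ℚ.+ 1ℚ) ^ℚ suc q)
  -- Taking the residue of x + 1 instead of x makes the exceptional class x ≡ -1 the case zero.
  binomℚ[p-1] {x} ix = go (residue i[x+1])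
    where
    i[x+1] : Integral (x ℚ.+ 1ℚ)
    i[x+1] = +-integral ix (ℕ-integral 1)
    x≈ : ∀ {y z} → x ℚ.+ 1ℚ ≈ y → y - 1ℚ ≡ z → x ≈ z
    x≈ {y} h eq = subst₂ _≈_ (solve 1 (λ x → (x :+ con 1ℚ) :- con 1ℚ := x) refl x) eq (+-cong h (≈-refl { - 1ℚ}))
    go : (∃ λ r → r < p × x ℚ.+ 1ℚ ≈ ℕ→ℚ r) → binomℚ x (suc q) ≈ 1ℚ - ((x ℚ.+ 1ℚ) ^ℚ suc q)
    go (zero , _ , h) = ≈-trans
      (≈-trans (binomℚ-cong ix −1-integral (x≈ h refl) 1+q<p)
        (≈-trans (≈-reflexive (binomℚ-−1 (suc q))) sgn[p-1]≈1))
      (≈-sym (subst (1ℚ - ((x ℚ.+ 1ℚ) ^ℚ suc q) ≈_) (cong (λ t → 1ℚ - t) (ℚₚ.*-zeroˡ (0ℚ ^ℚ q)))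
        (+-cong (≈-refl {1ℚ}) (neg-cong (^-cong i[x+1] (ℕ-integral 0) h (suc q))))))
    -- Here x ≡ s with s ≤ p - 2, so the binomial coefficient contains a zero factor, and the power
    -- of x + 1 is 1 by Fermat.
    go (suc s , s<p , h) = ≈-trans
      (≈-trans (binomℚ-cong ix (ℕ-integral s)
          (x≈ h (trans (cong (_- 1ℚ) (ℕ→ℚ-suc s)) (solve 1 (λ s → (con 1ℚ :+ s) :- con 1ℚ := s) refl (ℕ→ℚ s)))) 1+q<p)
        (≈-reflexive (binomℚ-vanishes (ℕₚ.≤-pred (subst (suc s <_) p≡2+q s<p)))))
      (≈-sym (+-cong (≈-refl {1ℚ})
        (neg-cong (≈-trans (^-cong i[x+1] (ℕ-integral (suc s)) h (suc q)) (fermat-unit (p∤< s<p))))))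

  -- The recursion modulo p

  Δ^-≈ : ∀ k {f g} → (∀ {y} → Integral y → f y ≈ g y) → ∀ {y} → Integral y → Δ^ k f y ≈ Δ^ k g y
  Δ^-≈ zero    h iy = h iy
  Δ^-≈ (suc k) h iy = +-cong (Δ^-≈ k h (+-integral iy (ℕ-integral 1))) (neg-cong (Δ^-≈ k h iy))

  -- Take differences of order k + 1 in `binomℚ[p-1]`: the lower index drops from p - 1 to `n` on
  -- the left, and the constant 1 vanishes on the right since the order is positive.
  binomℚ≈Δ^ : ∀ n k → n + suc k ≡ suc q → ∀ {x} → Integral x → binomℚ x n ≈ - Δ^ (suc k) (_^ℚ suc q) (x ℚ.+ 1ℚ)
  binomℚ≈Δ^ n k n+k≡ {x} ix = subst₂ _≈_
    (trans (cong (λ j → Δ^ (suc k) (λ z → binomℚ z j) x) (trans (sym n+k≡) (ℕₚ.+-comm n (suc k)))) (Δ^-binomℚ (suc k) n x))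
    (begin
      Δ^ (suc k) (λ z → 1ℚ - ((z ℚ.+ 1ℚ) ^ℚ suc q)) x
        ≡⟨ Δ^-cong (suc k) (λ z → solve 1 (λ a → con 1ℚ :- a := con 1ℚ :* con 1ℚ :+ (:- con 1ℚ) :* a) refl
             ((z ℚ.+ 1ℚ) ^ℚ suc q)) x ⟩
      Δ^ (suc k) (λ z → 1ℚ * 1ℚ ℚ.+ (- 1ℚ) * ((z ℚ.+ 1ℚ) ^ℚ suc q)) x
        ≡⟨ Δ^-linear (suc k) 1ℚ (- 1ℚ) (λ _ → 1ℚ) (λ z → (z ℚ.+ 1ℚ) ^ℚ suc q) x ⟩
      1ℚ * Δ^ (suc k) (λ _ → 1ℚ) x ℚ.+ (- 1ℚ) * Δ^ (suc k) (λ z → (z ℚ.+ 1ℚ) ^ℚ suc q) x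
        ≡⟨ cong₂ (λ a b → 1ℚ * a ℚ.+ (- 1ℚ) * b) (Δ^-const k 1ℚ x) (Δ^-shift (suc k) (_^ℚ suc q) x) ⟩
      1ℚ * 0ℚ ℚ.+ (- 1ℚ) * Δ^ (suc k) (_^ℚ suc q) (x ℚ.+ 1ℚ)
        ≡⟨ solve 1 (λ a → con 1ℚ :* con 0ℚ :+ (:- con 1ℚ) :* a := :- a) refl (Δ^ (suc k) (_^ℚ suc q) (x ℚ.+ 1ℚ)) ⟩
      - Δ^ (suc k) (_^ℚ suc q) (x ℚ.+ 1ℚ) ∎)
    (Δ^-≈ (suc k) binomℚ[p-1] ix)

  -- Both sequences have the same convolution with `logCoeff` modulo p. For i ≤ p - 2 the
  -- denominators i + 1 stay below p, and p - 1 - i, written `suc (q ∸ i)`, is positive as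
  -- `logCoeff⊛ℓΔ` demands.
  gregoryPoly≈ℓΔ : ∀ {x} → Integral x → ∀ n → n ≤ q → gregoryPoly n x ≈ ℓΔ p x n
  gregoryPoly≈ℓΔ {x} ix = ⊛-cancelˡ logCoeff (λ n → gregoryPoly n x) (ℓΔ p x) refl q
    (λ i i≤q → *-integral (sgn-integral i) (recip-integral (p∤< (ℕₚ.≤-<-trans (s≤s i≤q) 1+q<p))))
    (λ i i≤q → subst₂ _≈_ (sym (logCoeff⊛gregoryPoly i x))
      (sym (logCoeff⊛ℓΔ p≡2+q i (suc (q ∸ i)) (s≤s z≤n) (sum i≤q) x))
      (binomℚ≈Δ^ i (q ∸ i) (sum i≤q) ix))
    where
    sum : ∀ {i} → i ≤ q → i + suc (q ∸ i) ≡ suc q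
    sum {i} i≤q = trans (ℕₚ.+-suc i (q ∸ i)) (cong suc (ℕₚ.m+[n∸m]≡n i≤q))

-- The theorem's sign and the one from `alternatingSum` belong to consecutive exponents, so their
-- product is -1, the minus sign in `ℓΔ`.
ℓΔ-alternating : ∀ p k x → suc k ≤ p →
  sgn k * sumTo (suc k) (λ j → (sgn j * ℕ→ℚ (suc k C j)) * ℓ𝒜 (x ℚ.+ ℕ→ℚ (j + 1)) p) ≡ ℓΔ p x (p ∸ suc k)
ℓΔ-alternating p k x k<p = begin
  sgn k * sumTo (suc k) (λ j → (sgn j * ℕ→ℚ (suc k C j)) * ℓ𝒜 (x ℚ.+ ℕ→ℚ (j + 1)) p)
    ≡⟨ cong (sgn k *_) (sumTo-cong (suc k) (λ j _ → cong (λ y → (sgn j * ℕ→ℚ (suc k C j)) * ℓ𝒜 y p) (shift j))) ⟩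
  sgn k * sumTo (suc k) (λ j → (sgn j * ℕ→ℚ (suc k C j)) * ℓ𝒜 (x ℚ.+ 1ℚ ℚ.+ ℕ→ℚ j) p)
    ≡⟨ cong (sgn k *_) (alternatingSum (suc k) (λ y → ℓ𝒜 y p) (x ℚ.+ 1ℚ)) ⟩
  sgn k * ((- sgn k) * d)
    ≡⟨ solve 2 (λ s d → s :* ((:- s) :* d) := (s :* s) :* (:- d)) refl (sgn k) d ⟩
  (sgn k * sgn k) * (- d)
    ≡⟨ cong (_* (- d)) (sgn² k) ⟩
  1ℚ * (- d)
    ≡⟨ ℚₚ.*-identityˡ (- d) ⟩
  - d
    ≡⟨ cong (λ j → - Δ^ j (λ y → ℓ𝒜 y p) (x ℚ.+ 1ℚ)) (ℕₚ.m∸[m∸n]≡n k<p) ⟨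
  ℓΔ p x (p ∸ suc k) ∎
  where
  d : ℚ
  d = Δ^ (suc k) (λ y → ℓ𝒜 y p) (x ℚ.+ 1ℚ)
  shift : ∀ j → x ℚ.+ ℕ→ℚ (j + 1) ≡ x ℚ.+ 1ℚ ℚ.+ ℕ→ℚ j
  shift j = trans (cong (x ℚ.+_) (trans (cong ℕ→ℚ (ℕₚ.+-comm j 1)) (ℕ→ℚ-suc j))) (sym (ℚₚ.+-assoc x 1ℚ (ℕ→ℚ j)))

theorem3p8 : (k : ℕ) → 2 ≤ k → (x : ℚ) →
    G𝒜 k x ≈𝒜 (λ p → sgn (k ∸ 1) *
    sumTo k (λ j → (sgn j * ℕ→ℚ (k C j)) * ℓ𝒜 (x ℚ.+ ℕ→ℚ (j + 1)) p))
theorem3p8 (suc zero) (s≤s ())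
-- Primes above this bound exceed both the order of the difference, so that p - k is a true
-- subtraction, and the denominator of `x`, so that `x` is p-integral.
theorem3p8 (suc (suc k)) _ x = suc (suc k) + ℚ.↧ₙ x , λ p pr N<p →
  large p (p ∸ 2) (sym (ℕₚ.m+[n∸m]≡n (ℕₚ.≤-trans (s≤s (s≤s z≤n)) (ℕₚ.<⇒≤ N<p)))) pr N<p
  where
  large : ∀ p q → p ≡ suc (suc q) → Prime p → suc (suc k) + ℚ.↧ₙ x < p →
    ≡0mod p (gregoryPoly (p ∸ suc (suc k)) x - sgn (suc k) *
      sumTo (suc (suc k)) (λ j → (sgn j * ℕ→ℚ (suc (suc k) C j)) * ℓ𝒜 (x ℚ.+ ℕ→ℚ (j + 1)) p))
  large p q p≡2+q pr N<p = ≈⇒≡0mod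
    (subst (gregoryPoly (p ∸ suc (suc k)) x ≈_) (sym (ℓΔ-alternating p (suc k) x k≤p))
      (gregoryPoly≈ℓΔ ix (p ∸ suc (suc k)) bound))
    where
    open Modular p≡2+q pr
    k≤p : suc (suc k) ≤ p
    k≤p = ℕₚ.≤-trans (ℕₚ.m≤m+n (suc (suc k)) (ℚ.↧ₙ x)) (ℕₚ.<⇒≤ N<p)
    -- This is where k ≥ 2 enters: the Gregory index p - k lies in the range up to p - 2 of the
    -- recursion.
    bound : p ∸ suc (suc k) ≤ q
    bound = subst (λ t → t ∸ suc (suc k) ≤ q) (sym p≡2+q) (ℕₚ.m∸n≤m q k)
    ix : Integral x
    ix = integral (ℚ.↧ₙ x) (ℚ.↥ x) (Div.>⇒∤ (ℕₚ.≤-<-trans (ℕₚ.m≤n+m (ℚ.↧ₙ x) (suc (suc k))) N<p)) (↧-clear x)
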